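{- Let $d$ and $n$ be any positive integers such that $2d<n$. Then for every admissible pinnacle set $S\subseteq[n]$ with $|S|=d$, $$2^{n-d-1}\;\le\; p_S(n)\;\le\; d!\cdot (d+1)!\cdot 2^{n-2d-1}\cdot S(n-d,d+1),$$ where $S(\cdot,\cdot)$ denotes the Stirling number of the second kind. Both bounds are tight: for each such $d$ and $n$ there is an admissible pinnacle set $S\subseteq [n]$ with $|S|=d$ attaining equality in the upper bound, and there is an admissible pinnacle set $S\subseteq[n]$ with $|S|=d$ attaining equality in the lower bound.
   Context: Let $[n]=\{1,2,\ldots,n\}$ and let $S_n$ be the set of permutations of $[n]$, written as words $w=w(1)w(2)\cdots w(n)$. A pinnacle of $w\in S_n$ is a value $w(i)$ with $2\le i\le n-1$ and $w(i-1)<w(i)>w(i+1)$. The pinnacle set $\mathrm{Pin}(w)$ is the set of all pinnacles of $w$. A set $S$ is an admissible pinnacle set if $S=\mathrm{Pin}(w)$ for some $w\in S_k$ and some $k\ge1$. For a set $S$, $p_S(n)=|\{w\in S_n:\mathrm{Pin}(w)=S\}|$. The Stirling number of the second kind $S(a,b)$ is the number of partitions of an $a$-element set into $b$ nonempty blocks (this two-argument notation is unrelated to the pinnacle set $S$). -}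

module Defs where

open import Data.Bool.Properties using () renaming (_≟_ to _≟ᵇ_)
open import Data.Fin using (Fin; toℕ; _<_)
open import Data.Fin.Properties using (_≟_; _<?_; any?; all?)
open import Data.Fin.Subset using (Subset; inside; outside; _∈_; _∩_; Nonempty; Empty)
open import Data.Fin.Subset.Properties using (_∈?_; nonempty?)
open import Data.List using (List; []; _∷_; _++_; map; length; filter; allFin; cartesianProductWith)
open import Data.List.Relation.Unary.All as All using (All)
open import Data.List.Relation.Unary.AllPairs using (AllPairs; allPairs?)
open import Data.List.Relation.Unary.Any as Any using (Any)
open import Data.Nat using (ℕ; zero; suc; _≤_)
import Data.Nat.Properties as ℕ
open import Data.Product using (∃-syntax; _×_; map₂)
open import Data.Vec using (Vec; []; _∷_; lookup; tabulate)
import Data.Vec.Properties as Vec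
open import Function using (_⇔_; Injective; Surjective; Bijective)
open import Relation.Binary.PropositionalEquality using (_≡_; refl; trans; cong)
open import Relation.Nullary using (Dec; does; ¬?; _×-dec_; _→-dec_)
open import Relation.Nullary.Decidable using (map′)

-- Throughout, i : Fin n stands for the element suc (toℕ i) of [n] = {1,…,n},
-- both as a position and as a value.  A word of length n over [n] is a
-- Vec (Fin n) n, and a subset of [n] is a Subset n.

------------------------------------------------------------------------
-- Permutations

IsPermutation : ∀ {n} → Vec (Fin n) n → Set
IsPermutation w = Bijective _≡_ _≡_ (lookup w)

isPermutation? : ∀ {n} (w : Vec (Fin n) n) → Dec (IsPermutation w)
isPermutation? w = injective? ×-dec surjective?
  where
  injective? : Dec (Injective _≡_ _≡_ (lookup w))
  injective? = map′ (λ inj {i} {j} → inj i j) (λ inj i j → inj {i} {j})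
    (all? λ i → all? λ j → (lookup w i ≟ lookup w j) →-dec (i ≟ j))

  surjective? : Dec (Surjective _≡_ _≡_ (lookup w))
  surjective? = map′
    (λ sur v → map₂ (λ wi≡v j≡i → trans (cong (lookup w) j≡i) wi≡v) (sur v))
    (λ sur v → map₂ (λ eq → eq refl) (sur v))
    (all? λ v → any? λ i → lookup w i ≟ v)

------------------------------------------------------------------------
-- Pinnacles

IsPinnacle : ∀ {n} → Vec (Fin n) n → Fin n → Set
IsPinnacle w v = ∃[ h ] ∃[ i ] ∃[ j ]
  (toℕ i ≡ suc (toℕ h) × toℕ j ≡ suc (toℕ i) ×
   lookup w i ≡ v × lookup w h < lookup w i × lookup w j < lookup w i)

isPinnacle? : ∀ {n} (w : Vec (Fin n) n) (v : Fin n) → Dec (IsPinnacle w v)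
isPinnacle? w v = any? λ h → any? λ i → any? λ j →
  (toℕ i ℕ.≟ suc (toℕ h)) ×-dec (toℕ j ℕ.≟ suc (toℕ i)) ×-dec
  (lookup w i ≟ v) ×-dec (lookup w h <? lookup w i) ×-dec (lookup w j <? lookup w i)

Pin : ∀ {n} → Vec (Fin n) n → Subset n
Pin w = tabulate λ v → does (isPinnacle? w v)

-- A subset of [n] regarded as a set of natural numbers, so that subsets of
-- [n] and of [k] can be compared.
_∈ᴺ_ : ∀ {n} → ℕ → Subset n → Set
m ∈ᴺ S = ∃[ i ] (i ∈ S × m ≡ suc (toℕ i))

Admissible : ∀ {n} → Subset n → Set
Admissible S = ∃[ k ] (1 ≤ k × ∃[ w ] (IsPermutation {k} w × (∀ m → m ∈ᴺ S ⇔ m ∈ᴺ Pin w)))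

------------------------------------------------------------------------
-- Counting

-- All vectors of length n with entries from xs.
vectors : ∀ {A : Set} → List A → (n : ℕ) → List (Vec A n)
vectors xs zero    = [] ∷ []
vectors xs (suc n) = cartesianProductWith _∷_ xs (vectors xs n)

-- All sublists of length k, i.e. the k-element subsets of the entries when
-- these are distinct.
choose : ∀ {A : Set} → ℕ → List A → List (List A)
choose zero    _        = [] ∷ []
choose (suc k) []       = []
choose (suc k) (x ∷ xs) = map (x ∷_) (choose k xs) ++ choose (suc k) xs

-- p n S is the number p_S(n).
p : (n : ℕ) → Subset n → ℕ
p n S = length (filter
  (λ w → isPermutation? w ×-dec Vec.≡-dec _≟ᵇ_ (Pin w) S)
  (vectors (allFin n) n))

------------------------------------------------------------------------
-- Stirling numbers of the second kind

IsSetPartition : ∀ {a} → List (Subset a) → Set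
IsSetPartition {a} blocks =
  All Nonempty blocks ×
  AllPairs (λ B C → Empty (B ∩ C)) blocks ×
  (∀ (x : Fin a) → Any (x ∈_) blocks)

isSetPartition? : ∀ {a} (blocks : List (Subset a)) → Dec (IsSetPartition blocks)
isSetPartition? blocks =
  All.all? nonempty? blocks ×-dec
  allPairs? (λ B C → ¬? (nonempty? (B ∩ C))) blocks ×-dec
  all? (λ x → Any.any? (x ∈?_) blocks)

subsets : (a : ℕ) → List (Subset a)
subsets = vectors (outside ∷ inside ∷ [])

-- The blocks of a partition are unordered: each family of b subsets occurs
-- exactly once in choose b (subsets a).
stirling₂ : ℕ → ℕ → ℕ
stirling₂ a b = length (filter isSetPartition? (choose b (subsets a)))

{-# OPTIONS --safe #-}

-- Build a permutation of [n] by inserting the values 1, 2, …, n into a growing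
-- family of c unordered segments of the final word, with +∞ at both ends: a
-- value that is not a pinnacle opens a segment or is appended to one of the 2c
-- segment ends, and a pinnacle glues two of the c segments in one of c(c-1)
-- ways.  Hence p_S(n) = H 1 (bits S) for the transfer recursion H below.
-- Moving a pinnacle past a larger non-pinnacle only increases H, which gives
-- the upper bound at S = {n-d+1,…,n}; every step except the first multiplies
-- the weight H c · c! (c-1)! by at least 2 at a non-pinnacle and preserves it
-- at a pinnacle, which gives the lower bound, attained at S = {3,5,…,2d+1}.
-- The equality p_S(n) = H 1 (bits S) itself is proved by inserting n+1 into the
-- permutations of [n]: both sides satisfy p_S(n+1) = 2 p_S(n) and
-- p_{S ∪ {n+1}}(n+1) = (n-1-2|S|) p_S(n) + 2 ∑_{t ∈ [n] ∖ S} p_{S ∪ {t}}(n).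
module Submission where

open import Data.Bool using (Bool; true; false; if_then_else_; _∧_; _∨_)
open import Data.Bool.Properties using (∧-identityʳ; ∧-zeroʳ) renaming (_≟_ to _≟ᵇ_)
open import Data.Empty using (⊥)
open import Data.Fin using (Fin; zero; suc; toℕ; fromℕ<)
open import Data.Fin.Properties using (toℕ-injective; toℕ<n; toℕ-fromℕ<)
open import Data.Fin.Subset using (Subset; inside; outside; _∩_; Nonempty; Empty; ∣_∣) renaming (_∈_ to _∈ˢ_)
open import Data.Fin.Subset.Properties using (nonempty?; x∈p∩q⁺; x∈p∩q⁻; drop-there)
open import Data.List using (List; []; _∷_; _++_; [_]; _∷ʳ_; map; length; filter; concatMap; replicate; tabulate; applyDownFrom; downFrom; allFin; initLast; _∷ʳ′_)
open import Data.List.Membership.Propositional using (_∈_; _∉_; find)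
open import Data.List.Membership.Propositional.Properties using (∈-∃++; ∈-map⁻; ∈-map⁺; ∈-concatMap⁻; ∈-concatMap⁺; ∈-downFrom⁻; ∈-downFrom⁺; ∈-tabulate⁺; ∈-tabulate⁻; ∈-allFin; ∈-cartesianProductWith⁺; ∈-map∘filter⁻; ∈-map∘filter⁺; ∈-filter⁺; ∈-filter⁻; ∈-length)
open import Data.List.Membership.Propositional.Properties.WithK using (unique∧set⇒bag)
open import Data.List.Properties using (++-identityʳ; ≡-dec; ∷-injectiveʳ; ∷-injectiveˡ; filter-all; filter-accept; filter-reject; length-replicate; length-downFrom; length-applyDownFrom; applyDownFrom-∷ʳ; ∷ʳ-injective; length-++)
open import Data.List.Relation.Binary.BagAndSetEquality using (∼bag⇒↭)
open import Data.List.Relation.Binary.Permutation.Propositional using (_↭_; refl; prep; swap; trans; ↭-refl; ↭-sym; ↭-trans)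
open import Data.List.Relation.Binary.Permutation.Propositional.Properties using (All-resp-↭; Any-resp-↭; ∈-resp-↭; ++-comm; drop-mid; ↭-length)
open import Data.List.Relation.Unary.All as All using (All; []; _∷_)
import Data.List.Relation.Unary.All.Properties as All
open import Data.List.Relation.Unary.AllPairs as AllPairs using (AllPairs; []; _∷_)
import Data.List.Relation.Unary.AllPairs.Properties as AllPairs
open import Data.List.Relation.Unary.Any as Any using (Any; here; there)
import Data.List.Relation.Unary.Any.Properties as Any
open import Data.List.Relation.Unary.Unique.Propositional using (Unique)
import Data.List.Relation.Unary.Unique.Propositional.Properties as Unique
open import Data.Nat using (ℕ; zero; suc; _+_; _*_; _∸_; _^_; _!; _≤_; _<_; _>_; z≤n; s≤s; z<s; s≤s⁻¹; _≟_; _<?_)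
open import Data.Nat.Properties
open import Algebra.Properties.CommutativeSemigroup +-commutativeSemigroup using (interchange; x∙yz≈y∙xz)
open import Data.Nat.Tactic.RingSolver using (solve-∀)
open import Data.Product using (_×_; _,_; proj₁; proj₂; ∃-syntax)
open import Data.Sum using (_⊎_; inj₁; inj₂; [_,_]′)
open import Data.Vec using (Vec; []; _∷_; lookup; here; there)
import Data.Vec.Properties as Vec
open import Function using (_∘_; _⇔_; mk⇔; Equivalence; Injective; id; case_of_)
open import Relation.Binary using (Symmetric; _Respects_)
open import Relation.Binary.PropositionalEquality using (_≡_; _≢_; refl; sym; cong; cong₂; subst; subst₂; ≢-sym; module ≡-Reasoning) renaming (trans to ≡-trans)
open import Relation.Nullary using (Dec; yes; no; does; ¬_; ¬?; _×-dec_; _⊎-dec_; contradiction)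
open import Relation.Nullary.Decidable using (does-⇔; dec-true; dec-false)
open import Defs

-- Finite sums

-- The weight `c ! * (c - 1) !` is the number of ways to glue `c` segments into one by pinnacles
-- alone: c(c-1) · (c-1)(c-2) ⋯ 2·1. This is why a pinnacle preserves it, and why it reappears as
-- the factor d! (d+1)! of the upper bound. The segments themselves are never formalized: `H` is
-- only a function on bit lists, tied to permutations by a common recurrence in n. The obstacle is
-- that a new maximum does more than add a pinnacle: placed next to a pinnacle t it destroys t, so
-- the count for one set involves the counts for all sets with one more element. Permutations are
-- compared with `H 1` only, yet that `H` obeys the same recurrence is proved for every `c`, because
-- each bit relates different values of `c`. Admissibility may be witnessed in any S_k. It is turned
-- into positivity of `H 1`, which is insensitive to non-pinnacles added or removed at the top.
-- Subtraction is avoided throughout: negative terms are moved across the equation, and n is written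
-- as 1 + 2d + k.

∑ : {A : Set} → List A → (A → ℕ) → ℕ
∑ []       f = 0
∑ (x ∷ xs) f = f x + ∑ xs f

syntax ∑ xs (λ x → e) = ∑[ x ← xs ] e

private variable
  A B : Set

∑-cong-∈ : {f g : A → ℕ} (xs : List A) → (∀ {x} → x ∈ xs → f x ≡ g x) → ∑ xs f ≡ ∑ xs g
∑-cong-∈ []       f≗g = refl
∑-cong-∈ (x ∷ xs) f≗g = cong₂ _+_ (f≗g (here refl)) (∑-cong-∈ xs (f≗g ∘ there))

∑-cong : {f g : A → ℕ} (xs : List A) → (∀ x → f x ≡ g x) → ∑ xs f ≡ ∑ xs g
∑-cong xs f≗g = ∑-cong-∈ xs (λ {x} _ → f≗g x)

∑-zero : (xs : List A) → ∑[ _ ← xs ] 0 ≡ 0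
∑-zero []       = refl
∑-zero (_ ∷ xs) = ∑-zero xs

∑-++ : (xs ys : List A) {f : A → ℕ} → ∑ (xs ++ ys) f ≡ ∑ xs f + ∑ ys f
∑-++ []       ys     = refl
∑-++ (x ∷ xs) ys {f} = ≡-trans (cong (f x +_) (∑-++ xs ys)) (sym (+-assoc (f x) _ _))

∑-map : (h : A → B) (xs : List A) {f : B → ℕ} → ∑ (map h xs) f ≡ ∑ xs (f ∘ h)
∑-map h []           = refl
∑-map h (x ∷ xs) {f} = cong (f (h x) +_) (∑-map h xs)

∑-concatMap : (h : A → List B) (xs : List A) {f : B → ℕ} →
  ∑ (concatMap h xs) f ≡ ∑[ x ← xs ] ∑ (h x) f
∑-concatMap h []       = refl
∑-concatMap h (x ∷ xs) = ≡-trans (∑-++ (h x) _) (cong (∑ (h x) _ +_) (∑-concatMap h xs))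

∑-+ : (xs : List A) {f g : A → ℕ} → ∑[ x ← xs ] (f x + g x) ≡ ∑ xs f + ∑ xs g
∑-+ []               = refl
∑-+ (x ∷ xs) {f} {g} = ≡-trans (cong (f x + g x +_) (∑-+ xs)) (interchange (f x) (g x) _ _)

∑-*ˡ : (k : ℕ) (xs : List A) {f : A → ℕ} → ∑[ x ← xs ] (k * f x) ≡ k * ∑ xs f
∑-*ˡ k []           = sym (*-zeroʳ k)
∑-*ˡ k (x ∷ xs) {f} = ≡-trans (cong (k * f x +_) (∑-*ˡ k xs)) (sym (*-distribˡ-+ k (f x) _))

∑-swap : (xs : List A) (ys : List B) {f : A → B → ℕ} →
  ∑[ x ← xs ] ∑[ y ← ys ] f x y ≡ ∑[ y ← ys ] ∑[ x ← xs ] f x y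
∑-swap []       ys = sym (∑-zero ys)
∑-swap (x ∷ xs) ys = ≡-trans (cong (∑ ys _ +_) (∑-swap xs ys)) (sym (∑-+ ys))

∑-↭ : {xs ys : List A} {f : A → ℕ} → xs ↭ ys → ∑ xs f ≡ ∑ ys f
∑-↭         refl                  = refl
∑-↭ {f = f} (prep x σ)            = cong (f x +_) (∑-↭ σ)
∑-↭ {f = f} (swap {xs = xs} x y σ) = ≡-trans (x∙yz≈y∙xz (f x) (f y) (∑ xs f)) (cong (λ t → f y + (f x + t)) (∑-↭ σ))
∑-↭         (trans σ τ)           = ≡-trans (∑-↭ σ) (∑-↭ τ)

𝟙 : {P : Set} → Dec P → ℕ
𝟙 P? = if does P? then 1 else 0

𝟙-⇔ : {P Q : Set} → P ⇔ Q → (P? : Dec P) (Q? : Dec Q) → 𝟙 P? ≡ 𝟙 Q?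
𝟙-⇔ P⇔Q P? Q? = cong (if_then 1 else 0) (does-⇔ P⇔Q P? Q?)

𝟙-yes : {P : Set} → (P? : Dec P) → P → 𝟙 P? ≡ 1
𝟙-yes P? p = cong (if_then 1 else 0) (dec-true P? p)

𝟙-no : {P : Set} → (P? : Dec P) → ¬ P → 𝟙 P? ≡ 0
𝟙-no P? ¬p = cong (if_then 1 else 0) (dec-false P? ¬p)

length-filter-∑ : {R : A → Set} (R? : ∀ x → Dec (R x)) (xs : List A) →
  length (filter R? xs) ≡ ∑[ x ← xs ] 𝟙 (R? x)
length-filter-∑ R? []       = refl
length-filter-∑ R? (x ∷ xs) with does (R? x)
... | true  = cong suc (length-filter-∑ R? xs)
... | false = length-filter-∑ R? xs

∑-filter : {R : A → Set} (R? : ∀ x → Dec (R x)) (xs : List A) {f : A → ℕ} →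
  ∑[ x ← xs ] (𝟙 (R? x) * f x) ≡ ∑ (filter R? xs) f
∑-filter R? []           = refl
∑-filter R? (x ∷ xs) {f} with does (R? x)
... | true  = cong₂ _+_ (+-identityʳ (f x)) (∑-filter R? xs)
... | false = ∑-filter R? xs

𝟙-⊎ : {P Q R : Set} → R ⇔ (P ⊎ Q) → ¬ (P × Q) → (R? : Dec R) (P? : Dec P) (Q? : Dec Q) →
  𝟙 R? ≡ 𝟙 P? + 𝟙 Q?
𝟙-⊎ R⇔ P#Q R? (yes p) (yes q) = contradiction (p , q) P#Q
𝟙-⊎ R⇔ P#Q R? (yes p) (no _)  = 𝟙-yes R? (Equivalence.from R⇔ (inj₁ p))
𝟙-⊎ R⇔ P#Q R? (no _)  (yes q) = 𝟙-yes R? (Equivalence.from R⇔ (inj₂ q))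
𝟙-⊎ R⇔ P#Q R? (no ¬p) (no ¬q) = 𝟙-no R? ([ ¬p , ¬q ]′ ∘ Equivalence.to R⇔)

𝟙-× : {P Q : Set} → (P? : Dec P) (Q? : Dec Q) → 𝟙 (P? ×-dec Q?) ≡ 𝟙 P? * 𝟙 Q?
𝟙-× (yes _) Q? = sym (+-identityʳ (𝟙 Q?))
𝟙-× (no _)  Q? = refl

-- Stirling numbers of the second kind

-- Meant for `xs` and `ys` the subsets without and with a distinguished point: only families with
-- exactly one block through that point contribute. `choose` keeps the order of the list, so this
-- block comes last.
∑-choose-++ : {C : Set} (f : A → C) (g : B → C) (xs : List A) (ys : List B) (φ : List C → ℕ) →
  (∀ L M → length M ≢ 1 → φ (map f L ++ map g M) ≡ 0) → ∀ b →
  ∑ (choose (suc b) (map f xs ++ map g ys)) φ ≡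
  ∑[ y ← ys ] ∑[ L ← choose b xs ] φ (map f L ++ g y ∷ [])
∑-choose-++ f g [] ys φ φ≡0 zero = one ys
  where
  one : ∀ ys → ∑ (choose 1 (map g ys)) φ ≡ ∑[ y ← ys ] (φ (g y ∷ []) + 0)
  one []       = refl
  one (y ∷ ys) = ≡-trans (cong (φ (g y ∷ []) +_) (one ys))
    (cong (_+ (∑[ z ← ys ] (φ (g z ∷ []) + 0))) (sym (+-identityʳ (φ (g y ∷ [])))))
∑-choose-++ f g [] ys φ φ≡0 (suc b) = ≡-trans
  (∑-choose-zero (suc (suc b)) ys φ λ M ∣M∣ → φ≡0 [] M λ ∣M∣≡1 → case ≡-trans (sym ∣M∣) ∣M∣≡1 of λ ())
  (sym (∑-zero ys))
  where
  ∑-choose-zero : ∀ k ys (φ : List _ → ℕ) →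
    (∀ M → length M ≡ k → φ (map g M) ≡ 0) → ∑ (choose k (map g ys)) φ ≡ 0
  ∑-choose-zero zero    ys       φ φ≡0 = ≡-trans (+-identityʳ _) (φ≡0 [] refl)
  ∑-choose-zero (suc k) []       φ φ≡0 = refl
  ∑-choose-zero (suc k) (y ∷ ys) φ φ≡0 =
    ≡-trans (∑-++ (map (g y ∷_) (choose k (map g ys))) _)
    (cong₂ _+_
      (≡-trans (∑-map _ (choose k (map g ys)))
        (∑-choose-zero k ys (φ ∘ (g y ∷_)) λ M ∣M∣≡k → φ≡0 (y ∷ M) (cong suc ∣M∣≡k)))
      (∑-choose-zero (suc k) ys φ φ≡0))
∑-choose-++ f g (x ∷ xs) ys φ φ≡0 zero = ≡-trans
  (cong (_+ ∑ (choose 1 (map f xs ++ map g ys)) φ) (φ≡0 (x ∷ []) [] (λ ())))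
  (∑-choose-++ f g xs ys φ φ≡0 zero)
∑-choose-++ f g (x ∷ xs) ys φ φ≡0 (suc b) = begin
  ∑ (map (f x ∷_) (choose (suc b) zs) ++ choose (suc (suc b)) zs) φ
    ≡⟨ ∑-++ (map (f x ∷_) (choose (suc b) zs)) _ ⟩
  ∑ (map (f x ∷_) (choose (suc b) zs)) φ + ∑ (choose (suc (suc b)) zs) φ
    ≡⟨ cong₂ _+_
         (≡-trans (∑-map _ (choose (suc b) zs))
           (∑-choose-++ f g xs ys (φ ∘ (f x ∷_)) (λ L → φ≡0 (x ∷ L)) b))
         (∑-choose-++ f g xs ys φ φ≡0 (suc b)) ⟩
  (∑[ y ← ys ] ∑[ L ← choose b xs ] φ (f x ∷ map f L ++ g y ∷ [])) +
  (∑[ y ← ys ] ∑[ L ← choose (suc b) xs ] φ (map f L ++ g y ∷ []))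
    ≡⟨ ∑-+ ys ⟨
  ∑[ y ← ys ] ((∑[ L ← choose b xs ] φ (f x ∷ map f L ++ g y ∷ [])) +
               (∑[ L ← choose (suc b) xs ] φ (map f L ++ g y ∷ [])))
    ≡⟨ ∑-cong ys (λ y → ≡-trans (∑-++ (map (x ∷_) (choose b xs)) _)
         (cong (_+ (∑[ L ← choose (suc b) xs ] φ (map f L ++ g y ∷ []))) (∑-map _ (choose b xs)))) ⟨
  ∑[ y ← ys ] ∑[ L ← choose (suc b) (x ∷ xs) ] φ (map f L ++ g y ∷ []) ∎
  where
  open ≡-Reasoning
  zs = map f xs ++ map g ys

-- A pair `x`, `L` marks one entry of a sublist with `suc b` entries, and `x` need not stand first
-- in it; hence `φ` has to be symmetric, and to vanish when `x` already occurs in `L`. For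
-- partitions, the marked block is the one that receives the new point, which gives the factor
-- `suc b` of the Stirling recurrence.
∑-choose-pick : (xs : List A) (φ : List A → ℕ) →
  (∀ {L M} → L ↭ M → φ L ≡ φ M) → (∀ {x L} → x ∈ L → φ (x ∷ L) ≡ 0) → ∀ b →
  ∑[ x ← xs ] ∑[ L ← choose b xs ] φ (x ∷ L) ≡ suc b * ∑ (choose (suc b) xs) φ
∑-choose-pick []       φ φ-↭ φ≡0 b    = sym (*-zeroʳ b)
∑-choose-pick (x ∷ xs) φ φ-↭ φ≡0 zero = begin
  φ (x ∷ []) + 0 + (∑[ z ← xs ] ∑[ L ← choose 0 xs ] φ (z ∷ L))
    ≡⟨ cong₂ _+_ (+-identityʳ (φ (x ∷ []))) (∑-choose-pick xs φ φ-↭ φ≡0 zero) ⟩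
  φ (x ∷ []) + 1 * ∑ (choose 1 xs) φ
    ≡⟨ cong (φ (x ∷ []) +_) (*-identityˡ (∑ (choose 1 xs) φ)) ⟩
  ∑ (choose 1 (x ∷ xs)) φ
    ≡⟨ *-identityˡ (∑ (choose 1 (x ∷ xs)) φ) ⟨
  1 * ∑ (choose 1 (x ∷ xs)) φ ∎
  where open ≡-Reasoning
∑-choose-pick (x ∷ xs) φ φ-↭ φ≡0 (suc b) = begin
  (∑[ L ← choose (suc b) (x ∷ xs) ] φ (x ∷ L)) +
  (∑[ z ← xs ] ∑[ L ← choose (suc b) (x ∷ xs) ] φ (z ∷ L))
    ≡⟨ cong₂ _+_ (split b (λ L → φ (x ∷ L)))
         (≡-trans (∑-cong xs (λ z → split b (λ L → φ (z ∷ L)))) (∑-+ xs)) ⟩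
  ((∑[ L ← choose b xs ] φ (x ∷ x ∷ L)) + X) +
  ((∑[ z ← xs ] ∑[ L ← choose b xs ] φ (z ∷ x ∷ L)) +
   (∑[ z ← xs ] ∑[ L ← choose (suc b) xs ] φ (z ∷ L)))
    ≡⟨ cong₂ (λ s t → s + X + t)
         (≡-trans (∑-cong (choose b xs) (λ L → φ≡0 (here refl))) (∑-zero (choose b xs)))
         (cong₂ _+_
           (≡-trans
             (∑-cong xs λ z → ∑-cong (choose b xs) λ L → φ-↭ (swap z x refl))
             (∑-choose-pick xs (φ ∘ (x ∷_)) (φ-↭ ∘ prep x)
               (λ {z} z∈L → ≡-trans (φ-↭ (swap x z refl)) (φ≡0 (there z∈L))) b))
           (∑-choose-pick xs φ φ-↭ φ≡0 (suc b))) ⟩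
  X + (suc b * X + suc (suc b) * Y)
    ≡⟨ regroup b X Y ⟩
  suc (suc b) * (X + Y)
    ≡⟨ cong (suc (suc b) *_) (split (suc b) φ) ⟨
  suc (suc b) * ∑ (choose (suc (suc b)) (x ∷ xs)) φ ∎
  where
  open ≡-Reasoning
  X = ∑[ L ← choose (suc b) xs ] φ (x ∷ L)
  Y = ∑ (choose (suc (suc b)) xs) φ
  split : ∀ k (ψ : List _ → ℕ) →
    ∑ (choose (suc k) (x ∷ xs)) ψ ≡ ∑ (choose k xs) (ψ ∘ (x ∷_)) + ∑ (choose (suc k) xs) ψ
  split k ψ = ≡-trans (∑-++ (map (x ∷_) (choose k xs)) _) (cong (_+ _) (∑-map _ (choose k xs)))
  regroup : ∀ b X Y → X + (suc b * X + suc (suc b) * Y) ≡ suc (suc b) * (X + Y)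
  regroup = solve-∀

Disjoint : ∀ {a} → Subset a → Subset a → Set
Disjoint B C = Empty (B ∩ C)

disjoint-sym : ∀ {a} {B C : Subset a} → Disjoint B C → Disjoint C B
disjoint-sym {B = B} {C} B#C (x , x∈) =
  let (x∈C , x∈B) = x∈p∩q⁻ C B x∈ in B#C (x , x∈p∩q⁺ (x∈B , x∈C))

AllPairs-resp-↭ : {R : A → A → Set} → Symmetric R → (AllPairs R) Respects _↭_
AllPairs-resp-↭ R-sym refl         ps                    = ps
AllPairs-resp-↭ R-sym (prep x σ)   (p ∷ ps)              = All-resp-↭ σ p ∷ AllPairs-resp-↭ R-sym σ ps
AllPairs-resp-↭ R-sym (swap x y σ) ((p ∷ ps) ∷ (q ∷ qs)) =
  (R-sym p ∷ All-resp-↭ σ q) ∷ (All-resp-↭ σ ps ∷ AllPairs-resp-↭ R-sym σ qs)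
AllPairs-resp-↭ R-sym (trans σ τ)  ps                    = AllPairs-resp-↭ R-sym τ (AllPairs-resp-↭ R-sym σ ps)

isSetPartition-↭ : ∀ {a} {L M : List (Subset a)} → L ↭ M → IsSetPartition L → IsSetPartition M
isSetPartition-↭ L↭M (ne , dis , cov) =
  All-resp-↭ L↭M ne ,
  AllPairs-resp-↭ (λ {B C} → disjoint-sym {B = B} {C}) L↭M dis ,
  λ x → Any-resp-↭ L↭M (cov x)

isSetPartition-↭⇔ : ∀ {a} {L M : List (Subset a)} → L ↭ M → IsSetPartition L ⇔ IsSetPartition M
isSetPartition-↭⇔ L↭M = mk⇔ (isSetPartition-↭ L↭M) (isSetPartition-↭ (↭-sym L↭M))

isSetPartition-∈ : ∀ {a} {B : Subset a} {L} → B ∈ L → ¬ IsSetPartition (B ∷ L)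
isSetPartition-∈ {B = B} B∈L (((x , x∈B) ∷ _) , (B# ∷ _) , _) =
  All.lookup B# B∈L (x , x∈p∩q⁺ (x∈B , x∈B))

disjoint-∷⁻ : ∀ {n} s t (B C : Subset n) → Disjoint (s ∷ B) (t ∷ C) → Disjoint B C
disjoint-∷⁻ s t B C dis (x , x∈) = dis (suc x , there x∈)

disjoint-∷⁺ : ∀ {n} s (B C : Subset n) → Disjoint B C → Disjoint (s ∷ B) (outside ∷ C)
disjoint-∷⁺ inside  B C dis (suc x , there x∈) = dis (x , x∈)
disjoint-∷⁺ outside B C dis (suc x , there x∈) = dis (x , x∈)

nonempty-∷⁻ : ∀ {n} (B : Subset n) → Nonempty (outside ∷ B) → Nonempty B
nonempty-∷⁻ B (suc x , there x∈) = x , x∈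

nonempty-∷⁺ : ∀ {n} s (B : Subset n) → Nonempty B → Nonempty (s ∷ B)
nonempty-∷⁺ s B (x , x∈) = suc x , there x∈

-- Deleting the point zero from the block containing it leaves either an
-- empty block, to be dropped, or a partition with as many blocks.
isSetPartition-suc : ∀ {a} (L : List (Subset a)) (B : Subset a) →
  IsSetPartition (map (outside ∷_) L ++ (inside ∷ B) ∷ []) ⇔
  (Empty B × IsSetPartition L ⊎ IsSetPartition (B ∷ L))
isSetPartition-suc {a} L B = mk⇔ (to ∘ isSetPartition-↭ σ) (isSetPartition-↭ (↭-sym σ) ∘ from)
  where
  σ : map (outside ∷_) L ++ (inside ∷ B) ∷ [] ↭ (inside ∷ B) ∷ map (outside ∷_) L
  σ = ++-comm (map (outside ∷_) L) ((inside ∷ B) ∷ [])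

  to : IsSetPartition ((inside ∷ B) ∷ map (outside ∷_) L) →
       Empty B × IsSetPartition L ⊎ IsSetPartition (B ∷ L)
  to ((_ ∷ ne) , (B# ∷ dis) , cov) with nonempty? B
  ... | yes B≠∅ = inj₂ (B≠∅ ∷ ne′ , B#′ ∷ dis′ , cov′)
    where
    ne′  = All.map (λ {C} → nonempty-∷⁻ C) (All.map⁻ ne)
    B#′  = All.map (λ {C} → disjoint-∷⁻ inside outside B C) (All.map⁻ B#)
    dis′ = AllPairs.map (λ {C D} → disjoint-∷⁻ outside outside C D) (AllPairs.map⁻ dis)
    cov′ : ∀ x → Any (x ∈ˢ_) (B ∷ L)
    cov′ x with cov (suc x)
    ... | here x∈B  = here (drop-there x∈B)
    ... | there x∈L = there (Any.map drop-there (Any.map⁻ x∈L))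
  ... | no B≡∅ = inj₁ (B≡∅ , ne′ , dis′ , cov′)
    where
    ne′  = All.map (λ {C} → nonempty-∷⁻ C) (All.map⁻ ne)
    dis′ = AllPairs.map (λ {C D} → disjoint-∷⁻ outside outside C D) (AllPairs.map⁻ dis)
    cov′ : ∀ x → Any (x ∈ˢ_) L
    cov′ x with cov (suc x)
    ... | here x∈B  = contradiction (x , drop-there x∈B) B≡∅
    ... | there x∈L = Any.map drop-there (Any.map⁻ x∈L)

  extend : All Nonempty L → All (Disjoint B) L → AllPairs Disjoint L →
    (∀ x → Any (x ∈ˢ_) (B ∷ L)) → IsSetPartition ((inside ∷ B) ∷ map (outside ∷_) L)
  extend ne B# dis cov =
    (zero , here) ∷ All.map⁺ (All.map (λ {C} → nonempty-∷⁺ outside C) ne) ,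
    All.map⁺ (All.map (λ {C} → disjoint-∷⁺ inside B C) B#) ∷
      AllPairs.map⁺ (AllPairs.map (λ {C D} → disjoint-∷⁺ outside C D) dis) ,
    cov′
    where
    cov′ : ∀ x → Any (x ∈ˢ_) ((inside ∷ B) ∷ map (outside ∷_) L)
    cov′ zero    = here here
    cov′ (suc x) with cov x
    ... | here x∈B  = here (there x∈B)
    ... | there x∈L = there (Any.map⁺ (Any.map there x∈L))

  from : Empty B × IsSetPartition L ⊎ IsSetPartition (B ∷ L) →
         IsSetPartition ((inside ∷ B) ∷ map (outside ∷_) L)
  from (inj₁ (B≡∅ , ne , dis , cov)) = extend ne
    (All.tabulate λ {C} _ (x , x∈) → B≡∅ (x , proj₁ (x∈p∩q⁻ B C x∈))) dis (there ∘ cov)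
  from (inj₂ (_ ∷ ne , B# ∷ dis , cov)) = extend ne B# dis cov

-- The point `zero` would lie in no block, or in two blocks that are then not disjoint.
isSetPartition-two : ∀ {a} (L M : List (Subset a)) → length M ≢ 1 →
  ¬ IsSetPartition (map (outside ∷_) L ++ map (inside ∷_) M)
isSetPartition-two L [] _ (_ , _ , cov) = zero∉ L (cov zero)
  where
  zero∉ : ∀ L → ¬ Any (zero ∈ˢ_) (map (outside ∷_) L ++ [])
  zero∉ (_ ∷ L) (there z) = zero∉ L z
isSetPartition-two L (B ∷ []) M≢1 _ = M≢1 refl
isSetPartition-two L (B ∷ C ∷ M) _ (_ , dis , _) = ¬disjoint L dis
  where
  ¬disjoint : ∀ L → ¬ AllPairs Disjoint (map (outside ∷_) L ++ map (inside ∷_) (B ∷ C ∷ M))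
  ¬disjoint []      ((B#C ∷ _) ∷ _) = B#C (zero , here)
  ¬disjoint (_ ∷ L) (_ ∷ dis)       = ¬disjoint L dis

subsets-suc : ∀ a → subsets (suc a) ≡ map (outside ∷_) (subsets a) ++ map (inside ∷_) (subsets a)
subsets-suc a = cong (map (outside ∷_) (subsets a) ++_) (++-identityʳ _)

∑-subsets-empty : ∀ a → ∑[ B ← subsets a ] 𝟙 (¬? (nonempty? B)) ≡ 1
∑-subsets-empty zero    = refl
∑-subsets-empty (suc a) = begin
  ∑[ B ← subsets (suc a) ] 𝟙 (¬? (nonempty? B))
    ≡⟨ cong (λ Bs → ∑[ B ← Bs ] 𝟙 (¬? (nonempty? B))) (subsets-suc a) ⟩
  ∑[ B ← map (outside ∷_) (subsets a) ++ map (inside ∷_) (subsets a) ] 𝟙 (¬? (nonempty? B))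
    ≡⟨ ≡-trans (∑-++ (map (outside ∷_) (subsets a)) _)
         (cong₂ _+_ (∑-map _ (subsets a)) (∑-map _ (subsets a))) ⟩
  (∑[ B ← subsets a ] 𝟙 (¬? (nonempty? (outside ∷ B)))) + (∑[ B ← subsets a ] 𝟙 (¬? (nonempty? (inside ∷ B))))
    ≡⟨ cong₂ _+_
         (∑-cong (subsets a) λ B → 𝟙-⇔ (mk⇔ (_∘ nonempty-∷⁺ outside B) (_∘ nonempty-∷⁻ B))
           (¬? (nonempty? (outside ∷ B))) (¬? (nonempty? B)))
         (≡-trans (∑-cong (subsets a) λ B → 𝟙-no (¬? (nonempty? (inside ∷ B))) (λ ∅ → ∅ (zero , here)))
           (∑-zero (subsets a))) ⟩
  (∑[ B ← subsets a ] 𝟙 (¬? (nonempty? B))) + 0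
    ≡⟨ ≡-trans (+-identityʳ _) (∑-subsets-empty a) ⟩
  1 ∎
  where open ≡-Reasoning

stirling₂-∑ : ∀ a b → stirling₂ a b ≡ ∑[ L ← choose b (subsets a) ] 𝟙 (isSetPartition? L)
stirling₂-∑ a b = length-filter-∑ isSetPartition? (choose b (subsets a))

stirling₂-suc : ∀ a b → stirling₂ (suc a) (suc b) ≡ stirling₂ a b + suc b * stirling₂ a (suc b)
stirling₂-suc a b = begin
  stirling₂ (suc a) (suc b)
    ≡⟨ stirling₂-∑ (suc a) (suc b) ⟩
  ∑ (choose (suc b) (subsets (suc a))) part
    ≡⟨ cong (λ Bs → ∑ (choose (suc b) Bs) part) (subsets-suc a) ⟩
  ∑ (choose (suc b) (map (outside ∷_) (subsets a) ++ map (inside ∷_) (subsets a))) part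
    ≡⟨ ∑-choose-++ (outside ∷_) (inside ∷_) (subsets a) (subsets a) part
         (λ L M M≢1 → 𝟙-no (isSetPartition? _) (isSetPartition-two L M M≢1)) b ⟩
  ∑[ B ← subsets a ] ∑[ L ← choose b (subsets a) ] part (map (outside ∷_) L ++ (inside ∷ B) ∷ [])
    ≡⟨ ∑-cong (subsets a) (λ B → ≡-trans (∑-cong (choose b (subsets a)) (split B))
         (≡-trans (∑-+ (choose b (subsets a)))
           (cong (_+ (∑[ L ← choose b (subsets a) ] part (B ∷ L))) (∑-*ˡ (empty B) (choose b (subsets a)))))) ⟩
  ∑[ B ← subsets a ] (empty B * ∑ (choose b (subsets a)) part + (∑[ L ← choose b (subsets a) ] part (B ∷ L)))
    ≡⟨ ≡-trans (∑-+ (subsets a)) (cong₂ _+_ emptyBlock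
         (∑-choose-pick (subsets a) part (λ {L} {M} L↭M → 𝟙-⇔ (isSetPartition-↭⇔ L↭M) (isSetPartition? L) (isSetPartition? M))
           (λ {B} {L} B∈L → 𝟙-no (isSetPartition? (B ∷ L)) (isSetPartition-∈ B∈L)) b)) ⟩
  ∑ (choose b (subsets a)) part + suc b * ∑ (choose (suc b) (subsets a)) part
    ≡⟨ cong₂ (λ s t → s + suc b * t) (stirling₂-∑ a b) (stirling₂-∑ a (suc b)) ⟨
  stirling₂ a b + suc b * stirling₂ a (suc b) ∎
  where
  open ≡-Reasoning
  part : ∀ {n} → List (Subset n) → ℕ
  part L = 𝟙 (isSetPartition? L)
  empty : Subset a → ℕ
  empty B = 𝟙 (¬? (nonempty? B))
  split : ∀ B L → part (map (outside ∷_) L ++ (inside ∷ B) ∷ []) ≡ empty B * part L + part (B ∷ L)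
  split B L = ≡-trans
    (𝟙-⊎ (isSetPartition-suc L B) (λ { ((B≡∅ , _) , (B≠∅ ∷ _ , _)) → B≡∅ B≠∅ })
      (isSetPartition? _) (¬? (nonempty? B) ×-dec isSetPartition? L) (isSetPartition? (B ∷ L)))
    (cong (_+ part (B ∷ L)) (𝟙-× (¬? (nonempty? B)) (isSetPartition? L)))
  emptyBlock : ∑[ B ← subsets a ] (empty B * ∑ (choose b (subsets a)) part) ≡ ∑ (choose b (subsets a)) part
  emptyBlock = begin
    ∑[ B ← subsets a ] (empty B * K)   ≡⟨ ∑-cong (subsets a) (λ B → *-comm (empty B) K) ⟩
    ∑[ B ← subsets a ] (K * empty B)   ≡⟨ ∑-*ˡ K (subsets a) ⟩
    K * (∑[ B ← subsets a ] empty B)   ≡⟨ cong (K *_) (∑-subsets-empty a) ⟩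
    K * 1                              ≡⟨ *-identityʳ K ⟩
    K ∎
    where K = ∑ (choose b (subsets a)) part

stirling₂-zeroˡ : ∀ b → stirling₂ 0 (suc b) ≡ 0
stirling₂-zeroˡ zero    = refl
stirling₂-zeroˡ (suc b) = refl

stirling₂-zeroʳ : ∀ a → stirling₂ (suc a) 0 ≡ 0
stirling₂-zeroʳ a = ≡-trans (stirling₂-∑ (suc a) 0)
  (≡-trans (+-identityʳ _) (𝟙-no (isSetPartition? {suc a} []) λ (_ , _ , cov) → case cov zero of λ ()))

-- The transfer recursion

-- The head of a bit list records whether the largest value is a pinnacle; the
-- clauses with c = 0 say that segments, once opened, never disappear.
H : ℕ → List Bool → ℕ
H c       (true  ∷ r) = suc c * c * H (suc c) r
H zero    []          = 1
H (suc c) []          = 0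
H zero    (false ∷ r) = 0
H (suc c) (false ∷ r) = H c r + 2 * suc c * H (suc c) r

trues falses : List Bool → ℕ
trues  []          = 0
trues  (true  ∷ r) = suc (trues r)
trues  (false ∷ r) = trues r
falses []          = 0
falses (true  ∷ r) = falses r
falses (false ∷ r) = suc (falses r)

trues+falses : ∀ r → trues r + falses r ≡ length r
trues+falses []          = refl
trues+falses (true  ∷ r) = cong suc (trues+falses r)
trues+falses (false ∷ r) = ≡-trans (+-suc (trues r) (falses r)) (cong suc (trues+falses r))

flips : List Bool → List (List Bool)
flips []          = []
flips (false ∷ r) = (true ∷ r) ∷ map (false ∷_) (flips r)
flips (true  ∷ r) = map (true ∷_) (flips r)

-- Count in two ways the families of `c` segments on one more value, the new maximum being a
-- pinnacle. Cutting at the maximum leaves `suc c` segments. Deleting it leaves `c` segments with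
-- `length r - c` inner gaps: either the pinnacle set is `r` and the gap avoids the `2 * trues r`
-- gaps next to pinnacles, or the set has one more element and the gap is one of the two beside it.
-- The case `c = 1` is the recurrence for permutations.
H-flips : ∀ c r → suc c * c * H (suc c) r + (c + 2 * trues r) * H c r ≡
                  length r * H c r + 2 * ∑ (flips r) (H c)
H-flips zero    []          = refl
H-flips (suc c) []          = ≡-trans
  (cong (_+ (suc c + 0) * 0) (*-zeroʳ (suc (suc c) * suc c))) (*-zeroʳ (suc c + 0))
H-flips zero    (false ∷ r) = begin
  2 * trues r * 0                          ≡⟨ *-zeroʳ (2 * trues r) ⟩
  0                                        ≡⟨ cong (2 *_) (∑-zero (flips r)) ⟨
  2 * (∑[ _ ← flips r ] 0)                 ≡⟨ cong (2 *_) (∑-map (false ∷_) (flips r)) ⟨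
  2 * ∑ (map (false ∷_) (flips r)) (H 0)   ≡⟨ cong (_+ 2 * ∑ (map (false ∷_) (flips r)) (H 0)) (*-zeroʳ (length r)) ⟨
  length r * 0 + 2 * ∑ (map (false ∷_) (flips r)) (H 0) ∎
  where open ≡-Reasoning
H-flips (suc c) (false ∷ r) = begin
  suc (suc c) * suc c * (h₁ + 2 * suc (suc c) * h₂) + (suc c + 2 * q) * (h₀ + 2 * suc c * h₁)
    -- What remains beside the two induction hypotheses is one more copy of `H (suc c) (false ∷ r)`,
    -- since the length grows by one, and twice the term that flips the head.
    ≡⟨ lhs c q h₀ h₁ h₂ ⟩
  (suc c * c * h₁ + (c + 2 * q) * h₀) + 2 * suc c * (suc (suc c) * suc c * h₂ + (suc c + 2 * q) * h₁) +
    (h₀ + 2 * suc c * h₁ + 2 * (suc (suc c) * suc c * h₂))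
    ≡⟨ cong₂ (λ s t → s + 2 * suc c * t + (h₀ + 2 * suc c * h₁ + 2 * (suc (suc c) * suc c * h₂)))
         (H-flips c r) (H-flips (suc c) r) ⟩
  (m * h₀ + 2 * D₀) + 2 * suc c * (m * h₁ + 2 * D₁) +
    (h₀ + 2 * suc c * h₁ + 2 * (suc (suc c) * suc c * h₂))
    ≡⟨ rhs c m h₀ h₁ h₂ D₀ D₁ ⟩
  suc m * (h₀ + 2 * suc c * h₁) + 2 * (suc (suc c) * suc c * h₂ + (D₀ + 2 * suc c * D₁))
    ≡⟨ cong (λ t → suc m * (h₀ + 2 * suc c * h₁) + 2 * (suc (suc c) * suc c * h₂ + t))
         (≡-trans (∑-map (false ∷_) (flips r))
           (≡-trans (∑-+ (flips r)) (cong (D₀ +_) (∑-*ˡ (2 * suc c) (flips r))))) ⟨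
  suc m * (h₀ + 2 * suc c * h₁) +
    2 * (suc (suc c) * suc c * h₂ + ∑ (map (false ∷_) (flips r)) (H (suc c))) ∎
  where
  open ≡-Reasoning
  m = length r
  q = trues r
  h₀ = H c r
  h₁ = H (suc c) r
  h₂ = H (suc (suc c)) r
  D₀ = ∑ (flips r) (H c)
  D₁ = ∑ (flips r) (H (suc c))
  lhs : ∀ c q h₀ h₁ h₂ →
    suc (suc c) * suc c * (h₁ + 2 * suc (suc c) * h₂) + (suc c + 2 * q) * (h₀ + 2 * suc c * h₁) ≡
    (suc c * c * h₁ + (c + 2 * q) * h₀) + 2 * suc c * (suc (suc c) * suc c * h₂ + (suc c + 2 * q) * h₁) +
    (h₀ + 2 * suc c * h₁ + 2 * (suc (suc c) * suc c * h₂))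
  lhs = solve-∀
  rhs : ∀ c m h₀ h₁ h₂ D₀ D₁ → (m * h₀ + 2 * D₀) + 2 * suc c * (m * h₁ + 2 * D₁) +
    (h₀ + 2 * suc c * h₁ + 2 * (suc (suc c) * suc c * h₂)) ≡
    suc m * (h₀ + 2 * suc c * h₁) + 2 * (suc (suc c) * suc c * h₂ + (D₀ + 2 * suc c * D₁))
  rhs = solve-∀
H-flips c (true ∷ r) = begin
  suc c * c * (suc (suc c) * suc c * h₂) + (c + 2 * suc q) * (suc c * c * h₁)
    ≡⟨ lhs c q h₁ h₂ ⟩
  suc c * c * (suc (suc c) * suc c * h₂ + (suc c + 2 * q) * h₁) + suc c * c * h₁
    ≡⟨ cong (λ t → suc c * c * t + suc c * c * h₁) (H-flips (suc c) r) ⟩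
  suc c * c * (m * h₁ + 2 * D₁) + suc c * c * h₁
    ≡⟨ rhs c m h₁ D₁ ⟩
  suc m * (suc c * c * h₁) + 2 * (suc c * c * D₁)
    ≡⟨ cong (λ t → suc m * (suc c * c * h₁) + 2 * t)
         (≡-trans (∑-map (true ∷_) (flips r)) (∑-*ˡ (suc c * c) (flips r))) ⟨
  suc m * (suc c * c * h₁) + 2 * ∑ (map (true ∷_) (flips r)) (H c) ∎
  where
  open ≡-Reasoning
  m = length r
  q = trues r
  h₁ = H (suc c) r
  h₂ = H (suc (suc c)) r
  D₁ = ∑ (flips r) (H (suc c))
  lhs : ∀ c q h₁ h₂ →
    suc c * c * (suc (suc c) * suc c * h₂) + (c + 2 * suc q) * (suc c * c * h₁) ≡
    suc c * c * (suc (suc c) * suc c * h₂ + (suc c + 2 * q) * h₁) + suc c * c * h₁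
  lhs = solve-∀
  rhs : ∀ c m h₁ D₁ → suc c * c * (m * h₁ + 2 * D₁) + suc c * c * h₁ ≡
    suc m * (suc c * c * h₁) + 2 * (suc c * c * D₁)
  rhs = solve-∀

H-zero : ∀ b r → H 0 (b ∷ r) ≡ 0
H-zero true  r = refl
H-zero false r = refl

-- Upper bound

H-mono-∷ : ∀ r s → (∀ c → H c r ≤ H c s) → ∀ b c → H c (b ∷ r) ≤ H c (b ∷ s)
H-mono-∷ r s r≤s true  zero    = z≤n
H-mono-∷ r s r≤s true  (suc c) = *-monoʳ-≤ (suc (suc c) * suc c) (r≤s (suc (suc c)))
H-mono-∷ r s r≤s false zero    = z≤n
H-mono-∷ r s r≤s false (suc c) = +-mono-≤ (r≤s c) (*-monoʳ-≤ (2 * suc c) (r≤s (suc c)))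

-- Postponing a gluing leaves one segment more when the non-pinnacle is placed. If it opens a
-- segment, the later gluing has (c+1)c ways instead of c(c-1); if it is appended, there are 2(c+1)
-- ends instead of 2c.
H-swap : ∀ r c → H c (false ∷ true ∷ r) ≤ H c (true ∷ false ∷ r)
H-swap r zero    = z≤n
H-swap r (suc c) = m+n≤o⇒m≤o _ (≤-reflexive (identity c (H (suc c) r) (H (suc (suc c)) r)))
  where
  identity : ∀ c A B →
    suc c * c * A + 2 * suc c * (suc (suc c) * suc c * B) +
    (2 * suc c * A + 2 * suc c * suc (suc c) * B) ≡
    suc (suc c) * suc c * (A + 2 * suc (suc c) * B)
  identity = solve-∀

sorted : ℕ → ℕ → List Bool
sorted q p = replicate q true ++ replicate p false

trues-sorted : ∀ q p → trues (sorted q p) ≡ q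
trues-sorted (suc q) p       = cong suc (trues-sorted q p)
trues-sorted zero    zero    = refl
trues-sorted zero    (suc p) = trues-sorted zero p

H-false∷sorted : ∀ q p c → H c (false ∷ sorted q p) ≤ H c (sorted q (suc p))
H-false∷sorted zero    p c = ≤-refl
H-false∷sorted (suc q) p c = ≤-trans (H-swap (sorted q p) c)
  (H-mono-∷ (false ∷ sorted q p) (sorted q (suc p)) (H-false∷sorted q p) true c)

H≤H-sorted : ∀ r c → H c r ≤ H c (sorted (trues r) (falses r))
H≤H-sorted []          c = ≤-refl
H≤H-sorted (true  ∷ r) c = H-mono-∷ r (sorted (trues r) (falses r)) (H≤H-sorted r) true c
H≤H-sorted (false ∷ r) c = ≤-trans
  (H-mono-∷ r (sorted (trues r) (falses r)) (H≤H-sorted r) false c)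
  (H-false∷sorted (trues r) (falses r) c)

-- The factors (c+2)(c+1) of successive gluings telescope as quotients of consecutive weights (c+1)!
-- c!. The weights are multiplied out to avoid division.
H-replicate-true : ∀ q c r →
  H (suc c) (replicate q true ++ r) * (suc c ! * c !) ≡ suc (c + q) ! * (c + q) ! * H (suc (c + q)) r
H-replicate-true zero    c r rewrite +-identityʳ c = *-comm (H (suc c) r) _
H-replicate-true (suc q) c r rewrite +-suc c q = ≡-trans
  (regroup c (c !) (H (suc (suc c)) (replicate q true ++ r)))
  (H-replicate-true q (suc c) r)
  where
  regroup : ∀ c k h → suc (suc c) * suc c * h * (suc c * k * k) ≡ h * (suc (suc c) * (suc c * k) * (suc c * k))
  regroup = solve-∀

-- Without pinnacles a segment falls to its minimum and then rises, so a block of size s can be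
-- arranged in 2^(s-1) ways: each element but the least picks a side. Over a partition of `m` values
-- into `c` blocks this gives 2^(m-c), written here without subtraction.
H-replicate-false : ∀ m c → 2 ^ c * H c (replicate m false) ≡ 2 ^ m * stirling₂ m c
H-replicate-false zero    zero    = refl
H-replicate-false zero    (suc c) = ≡-trans (*-zeroʳ (2 ^ suc c)) (sym (cong (1 *_) (stirling₂-zeroˡ c)))
H-replicate-false (suc m) zero    = sym (≡-trans (cong (2 ^ suc m *_) (stirling₂-zeroʳ m)) (*-zeroʳ (2 ^ suc m)))
H-replicate-false (suc m) (suc c) = begin
  2 * 2 ^ c * (H c f + 2 * suc c * H (suc c) f)
    ≡⟨ lhs c (2 ^ c) (H c f) (H (suc c) f) ⟩
  2 * (2 ^ c * H c f) + 2 * suc c * (2 * 2 ^ c * H (suc c) f)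
    ≡⟨ cong₂ (λ s t → 2 * s + 2 * suc c * t) (H-replicate-false m c) (H-replicate-false m (suc c)) ⟩
  2 * (2 ^ m * stirling₂ m c) + 2 * suc c * (2 ^ m * stirling₂ m (suc c))
    ≡⟨ rhs c (2 ^ m) (stirling₂ m c) (stirling₂ m (suc c)) ⟩
  2 * 2 ^ m * (stirling₂ m c + suc c * stirling₂ m (suc c))
    ≡⟨ cong (2 * 2 ^ m *_) (stirling₂-suc m c) ⟨
  2 * 2 ^ m * stirling₂ (suc m) (suc c) ∎
  where
  open ≡-Reasoning
  f = replicate m false
  lhs : ∀ c t A B → 2 * t * (A + 2 * suc c * B) ≡ 2 * (t * A) + 2 * suc c * (2 * t * B)
  lhs = solve-∀
  rhs : ∀ c t A B → 2 * (t * A) + 2 * suc c * (t * B) ≡ 2 * t * (A + suc c * B)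
  rhs = solve-∀

H-sorted : ∀ d k → let m = suc (d + k) in
  H 1 (sorted d m) ≡ d ! * suc d ! * 2 ^ k * stirling₂ m (suc d)
H-sorted d k = begin
  H 1 (sorted d m)                                ≡⟨ *-identityʳ _ ⟨
  H 1 (sorted d m) * (1 ! * 0 !)                  ≡⟨ H-replicate-true d 0 (replicate m false) ⟩
  suc d ! * d ! * H (suc d) (replicate m false)   ≡⟨ cong (suc d ! * d ! *_) (*-cancelˡ-≡ _ _ (2 ^ suc d) {{m^n≢0 2 (suc d)}} eq) ⟩
  suc d ! * d ! * (2 ^ k * stirling₂ m (suc d))   ≡⟨ regroup (suc d !) (d !) (2 ^ k) (stirling₂ m (suc d)) ⟩
  d ! * suc d ! * 2 ^ k * stirling₂ m (suc d) ∎
  where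
  open ≡-Reasoning
  m = suc (d + k)
  eq : 2 ^ suc d * H (suc d) (replicate m false) ≡ 2 ^ suc d * (2 ^ k * stirling₂ m (suc d))
  eq = begin
    2 ^ suc d * H (suc d) (replicate m false)  ≡⟨ H-replicate-false m (suc d) ⟩
    2 ^ (suc d + k) * stirling₂ m (suc d)      ≡⟨ cong (_* stirling₂ m (suc d)) (^-distribˡ-+-* 2 (suc d) k) ⟩
    2 ^ suc d * 2 ^ k * stirling₂ m (suc d)    ≡⟨ *-assoc (2 ^ suc d) (2 ^ k) _ ⟩
    2 ^ suc d * (2 ^ k * stirling₂ m (suc d)) ∎
  regroup : ∀ a b t s → a * b * (t * s) ≡ b * a * t * s
  regroup = solve-∀

-- Lower bound

m+n>0 : ∀ m {n} → m + n > 0 → m > 0 ⊎ n > 0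
m+n>0 zero    n>0 = inj₂ n>0
m+n>0 (suc m) _   = inj₁ z<s

m*n>0 : ∀ m {n} → m * n > 0 → n > 0
m*n>0 m {zero}  mn>0 = contradiction (subst (_> 0) (*-zeroʳ m) mn>0) λ ()
m*n>0 m {suc n} _    = z<s

-- The factor 2 on the right pays for the smallest value, the only non-pinnacle that need not double
-- the weight. In a sum of two continuations it is enough to keep one that is positive.
H-lower : ∀ r c → H (suc c) r > 0 → 2 ^ falses r ≤ 2 * (H (suc c) r * (suc c ! * c !))
H-lower (true ∷ r) c h = ≤-trans (H-lower r (suc c) (m*n>0 (suc (suc c) * suc c) h))
  (≤-reflexive (regroup c (c !) (H (suc (suc c)) r)))
  where
  regroup : ∀ c k h → 2 * (h * (suc (suc c) * (suc c * k) * (suc c * k))) ≡ 2 * (suc (suc c) * suc c * h * (suc c * k * k))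
  regroup = solve-∀
H-lower (false ∷ r) c h with m+n>0 (H c r) h
-- Appending leaves the weight factor alone and has `2 * suc c` ends to choose from, at least 2.
... | inj₂ h₂ = ≤-trans
  (*-monoʳ-≤ 2 (H-lower r c (m*n>0 (2 * suc c) h₂)))
  (m+n≤o⇒m≤o _ (≤-reflexive (regroup c (H c r) (H (suc c) r) (suc c ! * c !))))
  where
  regroup : ∀ c A B k →
    2 * (2 * (B * k)) + (2 * A * k + 4 * c * B * k) ≡ 2 * ((A + 2 * suc c * B) * k)
  regroup = solve-∀
-- The smallest value opens the first segment, in one way and with weight 1: equality holds, using
-- up the spare factor 2.
H-lower (false ∷ []) zero h | inj₁ h₁ = ≤-refl
H-lower (false ∷ b ∷ r) zero h | inj₁ h₁ = contradiction (subst (_> 0) (H-zero b r) h₁) λ ()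
-- Opening one more segment is possible in a single way, but the weight grows by (c+2)(c+1) = 2 +
-- (c² + 3c).
H-lower (false ∷ r) (suc c) h | inj₁ h₁ = ≤-trans
  (*-monoʳ-≤ 2 (H-lower r c h₁))
  (m+n≤o⇒m≤o _ (≤-reflexive (regroup c (c !) (H (suc c) r) (H (suc (suc c)) r))))
  where
  regroup : ∀ c k A B →
    2 * (2 * (A * (suc c * k * k))) +
    2 * (A * (c * c + 3 * c) * (suc c * k * k) + 2 * suc (suc c) * B * (suc (suc c) * (suc c * k) * (suc c * k))) ≡
    2 * ((A + 2 * suc (suc c) * B) * (suc (suc c) * (suc c * k) * (suc c * k)))
  regroup = solve-∀

-- The pinnacle set {3,5,…,2d+1} in [1+2d+k].
sparse : ℕ → ℕ → List Bool
sparse zero    zero    = false ∷ []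
sparse (suc d) zero    = true ∷ false ∷ sparse d zero
sparse d       (suc k) = false ∷ sparse d k

H₀-sparse : ∀ d k → H 0 (sparse d k) ≡ 0
H₀-sparse zero    zero    = refl
H₀-sparse (suc d) zero    = refl
H₀-sparse zero    (suc k) = refl
H₀-sparse (suc d) (suc k) = refl

-- The `d + 1` non-pinnacles open at most `d + 1` segments, and `d` gluings bring these down to at
-- most one.
H₂-sparse : ∀ d c → H (suc (suc c)) (sparse d 0) ≡ 0
H₂-sparse zero    c = *-zeroʳ (2 * suc (suc c))
H₂-sparse (suc d) c = ≡-trans
  (cong₂ (λ s t → suc (suc (suc c)) * suc (suc c) * (s + 2 * suc (suc (suc c)) * t))
    (H₂-sparse d c) (H₂-sparse d (suc c)))
  (zeros (suc (suc (suc c)) * suc (suc c)) (2 * suc (suc (suc c))))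
  where
  zeros : ∀ a b → a * (0 + b * 0) ≡ 0
  zeros = solve-∀

-- Below a pinnacle the moves are forced: the preceding value must open a second segment, and the
-- pinnacle glues the two in one of 2 orders. Each of the `k` values on top goes to one of the 2
-- ends of the single segment.
H-sparse : ∀ d k → H 1 (sparse d k) ≡ 2 ^ (d + k)
H-sparse zero    zero    = refl
H-sparse (suc d) zero    = ≡-trans
  (cong₂ (λ s t → 2 * (s + 4 * t)) (H-sparse d 0) (H₂-sparse d 0))
  (cong (2 *_) (+-identityʳ (2 ^ (d + 0))))
H-sparse zero    (suc k) = cong₂ (λ s t → s + 2 * t) (H₀-sparse 0 k) (H-sparse zero k)
H-sparse (suc d) (suc k) = cong₂ (λ s t → s + 2 * t) (H₀-sparse (suc d) k)
  (≡-trans (H-sparse (suc d) k) (cong (2 ^_) (sym (+-suc d k))))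

trues-sparse : ∀ d k → trues (sparse d k) ≡ d
trues-sparse zero    zero    = refl
trues-sparse (suc d) zero    = cong suc (trues-sparse d 0)
trues-sparse zero    (suc k) = trues-sparse zero k
trues-sparse (suc d) (suc k) = trues-sparse (suc d) k

falses-sparse : ∀ d k → falses (sparse d k) ≡ suc (d + k)
falses-sparse zero    zero    = refl
falses-sparse (suc d) zero    = cong suc (falses-sparse d 0)
falses-sparse zero    (suc k) = cong suc (falses-sparse zero k)
falses-sparse (suc d) (suc k) = cong suc (≡-trans (falses-sparse (suc d) k) (cong suc (sym (+-suc d k))))

-- Permutations by insertion of the largest value

insertions : A → List A → List (List A)
insertions x []       = [ x ∷ [] ]
insertions x (y ∷ ys) = (x ∷ y ∷ ys) ∷ map (y ∷_) (insertions x ys)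

permutations : ℕ → List (List ℕ)
permutations zero    = [ [] ]
permutations (suc n) = concatMap (insertions n) (permutations n)

∈-insertions⁻ : ∀ {x : A} ys {zs} → zs ∈ insertions x ys → zs ↭ x ∷ ys
∈-insertions⁻ []       (here refl)   = ↭-refl
∈-insertions⁻ (y ∷ ys) (here refl)   = ↭-refl
∈-insertions⁻ (y ∷ ys) (there zs∈) with ∈-map⁻ (y ∷_) zs∈
... | us , us∈ , refl = ↭-trans (prep y (∈-insertions⁻ ys us∈)) (swap y _ ↭-refl)

∈-insertions⁺ : ∀ (x : A) ys zs → ys ++ x ∷ zs ∈ insertions x (ys ++ zs)
∈-insertions⁺ x []       []       = here refl
∈-insertions⁺ x []       (z ∷ zs) = here refl
∈-insertions⁺ x (y ∷ ys) zs       = there (∈-map⁺ (y ∷_) (∈-insertions⁺ x ys zs))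

∈-permutations⁻ : ∀ n {w} → w ∈ permutations n → w ↭ downFrom n
∈-permutations⁻ zero    (here refl) = ↭-refl
∈-permutations⁻ (suc n) w∈ with u , u∈ , w∈ins ← find (∈-concatMap⁻ (insertions n) w∈) =
  ↭-trans (∈-insertions⁻ u w∈ins) (prep n (∈-permutations⁻ n u∈))

∈-permutations⁺ : ∀ n {w} → w ↭ downFrom n → w ∈ permutations n
∈-permutations⁺ zero    {[]}    σ = here refl
∈-permutations⁺ zero    {x ∷ w} σ = case ↭-length σ of λ ()
∈-permutations⁺ (suc n) {w}     σ with ys , zs , refl ← ∈-∃++ (∈-resp-↭ (↭-sym σ) (here refl)) =
  ∈-concatMap⁺ (insertions n)
    (Any.map (λ { refl → ∈-insertions⁺ n ys zs }) (∈-permutations⁺ n (drop-mid ys [] σ)))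

downFrom-∌ : ∀ n {w} → w ↭ downFrom n → n ∉ w
downFrom-∌ n σ n∈w = <-irrefl refl (∈-downFrom⁻ (∈-resp-↭ σ n∈w))

-- Deleting the maximum undoes its insertion, so different permutations share no insertion; this
-- keeps the enumeration free of repetitions.
filter-insertions : ∀ n w {u} → n ∉ w → u ∈ insertions n w → filter (λ k → ¬? (k ≟ n)) u ≡ w
filter-insertions n []      n∉w (here refl) = filter-reject (λ k → ¬? (k ≟ n)) (λ n≢n → n≢n refl)
filter-insertions n (x ∷ w) n∉w (here refl) = ≡-trans
  (filter-reject (λ k → ¬? (k ≟ n)) (λ n≢n → n≢n refl))
  (filter-all (λ k → ¬? (k ≟ n)) (All.¬Any⇒All¬ (x ∷ w) (n∉w ∘ Any.map sym) ))
filter-insertions n (x ∷ w) n∉w (there u∈) with us , us∈ , refl ← ∈-map⁻ (x ∷_) u∈ = ≡-trans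
  (filter-accept (λ k → ¬? (k ≟ n)) (n∉w ∘ here ∘ sym))
  (cong (x ∷_) (filter-insertions n w (n∉w ∘ there) us∈))

insertions-unique : ∀ (x : A) w → x ∉ w → Unique (insertions x w)
insertions-unique x []      x∉w = [] ∷ []
insertions-unique x (y ∷ w) x∉w =
  All.tabulate (λ u∈ → λ { refl → let (_ , _ , eq) = ∈-map⁻ (y ∷_) u∈ in x∉w (here (∷-injectiveˡ eq)) }) ∷
  Unique.map⁺ ∷-injectiveʳ (insertions-unique x w (x∉w ∘ there))

concatMap-unique : ∀ {B : Set} (f : A → List B) {xs} → Unique xs →
  (∀ {x} → x ∈ xs → Unique (f x)) →
  (∀ {x y z} → x ∈ xs → y ∈ xs → z ∈ f x → z ∈ f y → x ≡ y) →
  Unique (concatMap f xs)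
concatMap-unique f []          _   _   = []
concatMap-unique f (x∉ ∷ xs!) fx! inj = Unique.++⁺ (fx! (here refl))
  (concatMap-unique f xs! (fx! ∘ there) (λ x∈ y∈ → inj (there x∈) (there y∈)))
  (λ (z∈ , z∈′) → let (y , y∈ , z∈fy) = find (∈-concatMap⁻ f z∈′) in
    All.lookup x∉ y∈ (inj (here refl) (there y∈) z∈ z∈fy))

permutations-unique : ∀ n → Unique (permutations n)
permutations-unique zero    = [] ∷ []
permutations-unique (suc n) = concatMap-unique (insertions n) (permutations-unique n)
  (λ {w} w∈ → insertions-unique n w (n∉ w∈))
  (λ {w} {v} w∈ v∈ u∈ u∈′ → ≡-trans (sym (filter-insertions n w (n∉ w∈) u∈)) (filter-insertions n v (n∉ v∈) u∈′))
  where
  n∉ : ∀ {w} → w ∈ permutations n → n ∉ w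
  n∉ w∈ = downFrom-∌ n (∈-permutations⁻ n w∈)

-- Sets of values as bit lists, the largest value first

-- Values are counted from 0 here, so the head of `b ∷ v` is the bit of the value `length v`.
mark : ℕ → List Bool → List Bool
mark k []      = []
mark k (b ∷ v) = if does (k ≟ length v) then true ∷ v else b ∷ mark k v

mark-top : ∀ {k b} v → k ≡ length v → mark k (b ∷ v) ≡ true ∷ v
mark-top {k} {b} v k≡ = cong (if_then true ∷ v else b ∷ mark k v) (dec-true (k ≟ length v) k≡)

mark-∷ : ∀ {k b} v → k ≢ length v → mark k (b ∷ v) ≡ b ∷ mark k v
mark-∷ {k} {b} v k≢ = cong (if_then true ∷ v else b ∷ mark k v) (dec-false (k ≟ length v) k≢)

length-mark : ∀ k v → length (mark k v) ≡ length v
length-mark k []      = refl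
length-mark k (b ∷ v) with does (k ≟ length v)
... | true  = refl
... | false = cong suc (length-mark k v)

-- Says that the bit of `k` exists as well as that it is false: exactly when marking `k` adds a new
-- element.
data Unset (k : ℕ) : List Bool → Set where
  here  : ∀ {v} → k ≡ length v → Unset k (false ∷ v)
  there : ∀ {b v} → Unset k v → Unset k (b ∷ v)

unset-< : ∀ {k v} → Unset k v → k < length v
unset-< (here refl) = n<1+n _
unset-< (there u)   = m<n⇒m<1+n (unset-< u)

unset-mark : ∀ {k j v} → k ≢ j → Unset k v → Unset k (mark j v)
unset-mark {k} {j} {_ ∷ v} k≢j (here k≡) rewrite mark-∷ {j} {false} v (λ j≡ → k≢j (≡-trans k≡ (sym j≡))) =
  here (≡-trans k≡ (sym (length-mark j v)))
unset-mark {k} {j} {b ∷ v} k≢j (there u) with does (j ≟ length v)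
... | true  = there u
... | false = there (unset-mark k≢j u)

unset-replicate : ∀ {k} n → k < n → Unset k (replicate n false)
unset-replicate {k} (suc n) k<1+n with k ≟ n
... | yes refl = here (sym (length-replicate n))
... | no k≢n   = there (unset-replicate n (≤∧≢⇒< (s≤s⁻¹ k<1+n) k≢n))

trues-mark : ∀ {k v} → Unset k v → trues (mark k v) ≡ suc (trues v)
trues-mark {v = false ∷ v} (here k≡) rewrite mark-top {b = false} v k≡ = refl
trues-mark {v = b ∷ v}     (there u) rewrite mark-∷ {b = b} v (<⇒≢ (unset-< u)) with b
... | true  = cong suc (trues-mark u)
... | false = trues-mark u

flops : List Bool → List (List Bool)
flops []          = []
flops (true  ∷ v) = (false ∷ v) ∷ map (true ∷_) (flops v)
flops (false ∷ v) = map (false ∷_) (flops v)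

length-flops : ∀ v {u} → u ∈ flops v → length u ≡ length v
length-flops (true  ∷ v) (here refl) = refl
length-flops (true  ∷ v) (there u∈) with _ , u∈ , refl ← ∈-map⁻ (true ∷_) u∈ = cong suc (length-flops v u∈)
length-flops (false ∷ v) u∈ with _ , u∈ , refl ← ∈-map⁻ (false ∷_) u∈ = cong suc (length-flops v u∈)

length-flips : ∀ v {u} → u ∈ flips v → length u ≡ length v
length-flips (false ∷ v) (here refl) = refl
length-flips (false ∷ v) (there u∈) with _ , u∈ , refl ← ∈-map⁻ (false ∷_) u∈ = cong suc (length-flips v u∈)
length-flips (true  ∷ v) u∈ with _ , u∈ , refl ← ∈-map⁻ (true ∷_) u∈ = cong suc (length-flips v u∈)

flops-mark : ∀ {k v} → Unset k v → (φ : List Bool → ℕ) →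
  ∑ (flops (mark k v)) φ ≡ φ v + ∑[ u ← flops v ] φ (mark k u)
flops-mark {k} {false ∷ v} (here k≡) φ rewrite mark-top {b = false} v k≡ = cong (φ (false ∷ v) +_) (begin
  ∑ (map (true ∷_) (flops v)) φ                ≡⟨ ∑-map (true ∷_) (flops v) ⟩
  ∑[ u ← flops v ] φ (true ∷ u)                ≡⟨ ∑-cong-∈ (flops v) (λ {u} u∈ → cong φ (mark-top u (≡-trans k≡ (sym (length-flops v u∈))))) ⟨
  ∑[ u ← flops v ] φ (mark k (false ∷ u))      ≡⟨ ∑-map (false ∷_) (flops v) ⟨
  ∑[ u ← map (false ∷_) (flops v) ] φ (mark k u) ∎)
  where open ≡-Reasoning
flops-mark {k} {b ∷ v} (there u) φ rewrite mark-∷ {b = b} v (<⇒≢ (unset-< u)) = step b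
  where
  open ≡-Reasoning
  below : ∀ b → ∑ (map (b ∷_) (flops (mark k v))) φ ≡
    φ (b ∷ v) + ∑[ u ← map (b ∷_) (flops v) ] φ (mark k u)
  below b = begin
    ∑ (map (b ∷_) (flops (mark k v))) φ                ≡⟨ ∑-map (b ∷_) (flops (mark k v)) ⟩
    ∑[ u ← flops (mark k v) ] φ (b ∷ u)                ≡⟨ flops-mark u (φ ∘ (b ∷_)) ⟩
    φ (b ∷ v) + ∑[ u ← flops v ] φ (b ∷ mark k u)      ≡⟨ cong (φ (b ∷ v) +_) (∑-cong-∈ (flops v) λ {w} w∈ →
                                                            cong φ (mark-∷ w (λ k≡ → <⇒≢ (unset-< u) (≡-trans k≡ (length-flops v w∈))))) ⟨
    φ (b ∷ v) + ∑[ u ← flops v ] φ (mark k (b ∷ u))    ≡⟨ cong (φ (b ∷ v) +_) (∑-map (b ∷_) (flops v)) ⟨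
    φ (b ∷ v) + ∑[ u ← map (b ∷_) (flops v) ] φ (mark k u) ∎
  step : ∀ b → ∑ (flops (b ∷ mark k v)) φ ≡ φ (b ∷ v) + ∑[ u ← flops (b ∷ v) ] φ (mark k u)
  step false = below false
  step true  = begin
    φ (false ∷ mark k v) + ∑ (map (true ∷_) (flops (mark k v))) φ
      ≡⟨ cong₂ (λ s t → φ s + t) (sym (mark-∷ v (<⇒≢ (unset-< u)))) (below true) ⟩
    φ (mark k (false ∷ v)) + (φ (true ∷ v) + ∑[ u ← map (true ∷_) (flops v) ] φ (mark k u))
      ≡⟨ x∙yz≈y∙xz (φ (mark k (false ∷ v))) (φ (true ∷ v)) _ ⟩
    φ (true ∷ v) + (φ (mark k (false ∷ v)) + ∑[ u ← map (true ∷_) (flops v) ] φ (mark k u)) ∎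

infix 4 _≟ˡ_
_≟ˡ_ : (u v : List Bool) → Dec (u ≡ v)
_≟ˡ_ = ≡-dec _≟ᵇ_

-- Removing an element from `v` yields `r` exactly when adding one to `r` yields `v`. This turns a
-- sum over the pinnacles that a gap can destroy in a fixed word into a sum over the larger sets
-- with which the word is compared.
flops-flips : ∀ v r → ∑[ u ← flops v ] 𝟙 (u ≟ˡ r) ≡ ∑[ s ← flips r ] 𝟙 (v ≟ˡ s)
flops-flips []          []          = refl
flops-flips []          (false ∷ r) = sym (≡-trans (∑-map (false ∷_) (flips r)) (∑-zero (flips r)))
flops-flips []          (true  ∷ r) = sym (≡-trans (∑-map (true ∷_) (flips r)) (∑-zero (flips r)))
flops-flips (false ∷ v) []          = ≡-trans (∑-map (false ∷_) (flops v)) (∑-zero (flops v))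
flops-flips (true  ∷ v) []          = ≡-trans (∑-map (true ∷_) (flops v)) (∑-zero (flops v))
flops-flips (false ∷ v) (false ∷ r) = begin
  ∑[ u ← map (false ∷_) (flops v) ] 𝟙 (u ≟ˡ false ∷ r)   ≡⟨ ∑-map (false ∷_) (flops v) ⟩
  ∑[ u ← flops v ] 𝟙 (u ≟ˡ r)                            ≡⟨ flops-flips v r ⟩
  ∑[ s ← flips r ] 𝟙 (v ≟ˡ s)                            ≡⟨ ∑-map (false ∷_) (flips r) ⟨
  ∑[ s ← map (false ∷_) (flips r) ] 𝟙 (false ∷ v ≟ˡ s) ∎
  where open ≡-Reasoning
flops-flips (false ∷ v) (true  ∷ r) = ≡-trans
  (≡-trans (∑-map (false ∷_) (flops v)) (∑-zero (flops v)))
  (sym (≡-trans (∑-map (true ∷_) (flips r)) (∑-zero (flips r))))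
flops-flips (true  ∷ v) (false ∷ r) = cong (𝟙 (v ≟ˡ r) +_) (≡-trans
  (≡-trans (∑-map (true ∷_) (flops v)) (∑-zero (flops v)))
  (sym (≡-trans (∑-map (false ∷_) (flips r)) (∑-zero (flips r)))))
flops-flips (true  ∷ v) (true  ∷ r) = begin
  ∑[ u ← map (true ∷_) (flops v) ] 𝟙 (u ≟ˡ true ∷ r)     ≡⟨ ∑-map (true ∷_) (flops v) ⟩
  ∑[ u ← flops v ] 𝟙 (u ≟ˡ r)                            ≡⟨ flops-flips v r ⟩
  ∑[ s ← flips r ] 𝟙 (v ≟ˡ s)                            ≡⟨ ∑-map (true ∷_) (flips r) ⟨
  ∑[ s ← map (true ∷_) (flips r) ] 𝟙 (true ∷ v ≟ˡ s) ∎
  where open ≡-Reasoning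

-- Pinnacles of words and insertion of the maximum

isPeak? : ∀ x y z → Dec (x < y × z < y)
isPeak? x y z = (x <? y) ×-dec (z <? y)

markPeak : ℕ → ℕ → ℕ → List Bool → List Bool
markPeak x y z v = if does (isPeak? x y z) then mark y v else v

-- Scans the triples of consecutive letters, so that the effect of an insertion can be followed by
-- induction on the word. `bits-Pin` identifies it with `Pin`.
pinBits : ℕ → List ℕ → List Bool
pinBits n (x ∷ w@(y ∷ z ∷ _)) = markPeak x y z (pinBits n w)
pinBits n _                   = replicate n false

markPeak-yes : ∀ {x y z} v → x < y → z < y → markPeak x y z v ≡ mark y v
markPeak-yes {x} {y} {z} v x<y z<y = cong (if_then mark y v else v) (dec-true (isPeak? x y z) (x<y , z<y))

markPeak-no : ∀ {x y z} v → ¬ (x < y × z < y) → markPeak x y z v ≡ v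
markPeak-no {x} {y} {z} v ¬peak = cong (if_then mark y v else v) (dec-false (isPeak? x y z) ¬peak)

markPeak-elim : ∀ x y z v (Q : List Bool → Set) → Q (mark y v) → Q v → Q (markPeak x y z v)
markPeak-elim x y z v Q marked unmarked with does (isPeak? x y z)
... | true  = marked
... | false = unmarked

markPeak-∷ : ∀ x y z {b} v → y < length v → markPeak x y z (b ∷ v) ≡ b ∷ markPeak x y z v
markPeak-∷ x y z v y< with does (isPeak? x y z)
... | true  = mark-∷ v (<⇒≢ y<)
... | false = refl

length-pinBits : ∀ n w → length (pinBits n w) ≡ n
length-pinBits n []                  = length-replicate n
length-pinBits n (x ∷ [])            = length-replicate n
length-pinBits n (x ∷ y ∷ [])        = length-replicate n
length-pinBits n (x ∷ w@(y ∷ z ∷ _)) = markPeak-elim x y z (pinBits n w) (λ v → length v ≡ n)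
  (≡-trans (length-mark y (pinBits n w)) (length-pinBits n w)) (length-pinBits n w)

unset-pinBits : ∀ {k n} w → k < n → k ∉ w → Unset k (pinBits n w)
unset-pinBits     []                  k<n k∉ = unset-replicate _ k<n
unset-pinBits     (x ∷ [])            k<n k∉ = unset-replicate _ k<n
unset-pinBits     (x ∷ y ∷ [])        k<n k∉ = unset-replicate _ k<n
unset-pinBits {k} (x ∷ w@(y ∷ z ∷ _)) k<n k∉ = markPeak-elim x y z (pinBits _ w) (Unset k)
  (unset-mark (λ k≡y → k∉ (there (here k≡y))) (unset-pinBits w k<n (k∉ ∘ there)))
  (unset-pinBits w k<n (k∉ ∘ there))

-- The first letter is never in the middle of a triple, and without repetitions no later mark hits
-- it.
unset-pinBits-head : ∀ {k n} w → k < n → k ∉ w → Unset k (pinBits n (k ∷ w))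
unset-pinBits-head []              k<n k∉ = unset-replicate _ k<n
unset-pinBits-head (y ∷ [])        k<n k∉ = unset-replicate _ k<n
unset-pinBits-head {k} (y ∷ w@(z ∷ _)) k<n k∉ with does (isPeak? k y z)
... | true  = unset-mark (k∉ ∘ here) (unset-pinBits (y ∷ w) k<n k∉)
... | false = unset-pinBits (y ∷ w) k<n k∉

pinBits-suc : ∀ n w → All (_< n) w → pinBits (suc n) w ≡ false ∷ pinBits n w
pinBits-suc n []                  _            = refl
pinBits-suc n (x ∷ [])            _            = refl
pinBits-suc n (x ∷ y ∷ [])        _            = refl
pinBits-suc n (x ∷ w@(y ∷ z ∷ _)) (_ ∷ w<n@(y<n ∷ _)) = ≡-trans
  (cong (markPeak x y z) (pinBits-suc n w w<n))
  (markPeak-∷ x y z (pinBits n w) (subst (y <_) (sym (length-pinBits n w)) y<n))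

pinBits-descent : ∀ n x y w → y < x → pinBits n (x ∷ y ∷ w) ≡ pinBits n (y ∷ w)
pinBits-descent n x y []      y<x = refl
pinBits-descent n x y (z ∷ w) y<x = markPeak-no _ λ (x<y , _) → <-asym x<y y<x

pinBits-max∷ : ∀ n w → All (_< n) w → pinBits (suc n) (n ∷ w) ≡ false ∷ pinBits n w
pinBits-max∷ n []          _           = refl
pinBits-max∷ n w@(y ∷ w′)  w<n@(y<n ∷ _) = ≡-trans (pinBits-descent (suc n) n y w′ y<n) (pinBits-suc n w w<n)

pinBits-∷ʳmax : ∀ n w → All (_< n) w → pinBits (suc n) (w ++ [ n ]) ≡ false ∷ pinBits n w
pinBits-∷ʳmax n []                  _                     = refl
pinBits-∷ʳmax n (x ∷ [])            _                     = refl
pinBits-∷ʳmax n (x ∷ y ∷ [])        (_ ∷ y<n ∷ [])        = markPeak-no {x} _ λ (_ , n<y) → <-asym n<y y<n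
pinBits-∷ʳmax n (x ∷ w@(y ∷ z ∷ _)) (_ ∷ w<n@(y<n ∷ _)) = ≡-trans
  (cong (markPeak x y z) (pinBits-∷ʳmax n w w<n))
  (markPeak-∷ x y z (pinBits n w) (subst (y <_) (sym (length-pinBits n w)) y<n))

pinBits-max : ∀ n x y w → All (_< n) (x ∷ y ∷ w) →
  pinBits (suc n) (x ∷ n ∷ y ∷ w) ≡ true ∷ pinBits n (y ∷ w)
pinBits-max n x y w (x<n ∷ y∷w<n@(y<n ∷ _)) = begin
  markPeak x n y (pinBits (suc n) (n ∷ y ∷ w))   ≡⟨ markPeak-yes _ x<n y<n ⟩
  mark n (pinBits (suc n) (n ∷ y ∷ w))           ≡⟨ cong (mark n) (pinBits-max∷ n (y ∷ w) y∷w<n) ⟩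
  mark n (false ∷ pinBits n (y ∷ w))             ≡⟨ mark-top _ (sym (length-pinBits n (y ∷ w))) ⟩
  true ∷ pinBits n (y ∷ w) ∎
  where open ≡-Reasoning

-- The end gaps are split off because a maximum placed there is not a pinnacle and destroys none.
innerInsertions : {A : Set} → A → List A → List (List A)
innerInsertions x []           = []
innerInsertions x (y ∷ [])     = []
innerInsertions x (y ∷ z ∷ w)  = (y ∷ x ∷ z ∷ w) ∷ map (y ∷_) (innerInsertions x (z ∷ w))

∑-insertions : {A : Set} (x y : A) (w : List A) (f : List A → ℕ) →
  ∑ (insertions x (y ∷ w)) f ≡
  f (x ∷ y ∷ w) + f (y ∷ w ++ [ x ]) + ∑ (innerInsertions x (y ∷ w)) f
∑-insertions x y []      f = sym (+-assoc (f (x ∷ y ∷ [])) (f (y ∷ x ∷ [])) 0)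
∑-insertions x y (z ∷ w) f = begin
  f (x ∷ y ∷ z ∷ w) + ∑ (map (y ∷_) (insertions x (z ∷ w))) f
    ≡⟨ cong (f (x ∷ y ∷ z ∷ w) +_) (≡-trans (∑-map (y ∷_) (insertions x (z ∷ w))) (∑-insertions x z w (f ∘ (y ∷_)))) ⟩
  f (x ∷ y ∷ z ∷ w) + (f (y ∷ x ∷ z ∷ w) + f (y ∷ z ∷ w ++ [ x ]) + S)
    ≡⟨ regroup (f (x ∷ y ∷ z ∷ w)) (f (y ∷ x ∷ z ∷ w)) (f (y ∷ z ∷ w ++ [ x ])) S ⟩
  f (x ∷ y ∷ z ∷ w) + f (y ∷ z ∷ w ++ [ x ]) + (f (y ∷ x ∷ z ∷ w) + S)
    ≡⟨ cong (λ s → f (x ∷ y ∷ z ∷ w) + f (y ∷ z ∷ w ++ [ x ]) + (f (y ∷ x ∷ z ∷ w) + s))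
         (∑-map (y ∷_) (innerInsertions x (z ∷ w))) ⟨
  f (x ∷ y ∷ z ∷ w) + f (y ∷ z ∷ w ++ [ x ]) + ∑ (innerInsertions x (y ∷ z ∷ w)) f ∎
  where
  open ≡-Reasoning
  S = ∑[ u ← innerInsertions x (z ∷ w) ] f (y ∷ u)
  regroup : ∀ a b c s → a + (b + c + s) ≡ a + c + (b + s)
  regroup = solve-∀

flops-replicate : ∀ n → flops (replicate n false) ≡ []
flops-replicate zero    = refl
flops-replicate (suc n) = cong (map (false ∷_)) (flops-replicate n)

trues-replicate : ∀ n → trues (replicate n false) ≡ 0
trues-replicate zero    = refl
trues-replicate (suc n) = trues-replicate n

∈-innerInsertions-head : {A : Set} {x z : A} (w : List A) {u : List A} →
  u ∈ innerInsertions x (z ∷ w) → ∃[ v ] u ≡ z ∷ v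
∈-innerInsertions-head (y ∷ w) (here refl) = _ , refl
∈-innerInsertions-head {z = z} (y ∷ w) (there u∈) with v , _ , refl ← ∈-map⁻ (z ∷_) u∈ = v , refl

∑-innerInsertions-∷∷ : ∀ n y z r → All (_< n) (y ∷ z ∷ r) → (φ : List Bool → ℕ) →
  ∑[ u ← innerInsertions n (y ∷ z ∷ r) ] φ (pinBits (suc n) u) ≡
  φ (true ∷ pinBits n (z ∷ r)) + ∑[ u ← innerInsertions n (z ∷ r) ] φ (pinBits (suc n) (y ∷ u))
∑-innerInsertions-∷∷ n y z r <n φ =
  cong₂ _+_ (cong φ (pinBits-max n y z r <n)) (∑-map (y ∷_) (innerInsertions n (z ∷ r)))

-- Only the two gaps beside `y` break the triple `x`, `y`, `z`. In all gaps further right the triple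
-- survives, so its mark can be taken outside the remaining scan.
∑-innerInsertions-∷∷∷ : ∀ n x y z r → All (_< n) (x ∷ y ∷ z ∷ r) → (φ : List Bool → ℕ) →
  ∑[ u ← innerInsertions n (x ∷ y ∷ z ∷ r) ] φ (pinBits (suc n) u) ≡
  φ (true ∷ pinBits n (y ∷ z ∷ r)) + (φ (true ∷ pinBits n (z ∷ r)) +
    ∑[ u ← innerInsertions n (z ∷ r) ] φ (markPeak x y z (pinBits (suc n) (y ∷ u))))
∑-innerInsertions-∷∷∷ n x y z r <n@(_ ∷ yzr<n@(y<n ∷ _)) φ = begin
  ∑[ u ← innerInsertions n (x ∷ y ∷ z ∷ r) ] φ (pinBits (suc n) u)
    ≡⟨ ∑-innerInsertions-∷∷ n x y (z ∷ r) <n φ ⟩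
  φ (true ∷ pinBits n (y ∷ z ∷ r)) +
    (φ (markPeak x y n (pinBits (suc n) (y ∷ n ∷ z ∷ r))) +
     ∑[ u ← map (y ∷_) (innerInsertions n (z ∷ r)) ] φ (pinBits (suc n) (x ∷ u)))
    ≡⟨ cong (φ (true ∷ pinBits n (y ∷ z ∷ r)) +_) (cong₂ _+_
         (cong φ (≡-trans (markPeak-no {x} _ (λ (_ , n<y) → <-asym n<y y<n)) (pinBits-max n y z r yzr<n)))
         (≡-trans (∑-map (y ∷_) (innerInsertions n (z ∷ r)))
           (∑-cong-∈ (innerInsertions n (z ∷ r)) λ u∈ → case ∈-innerInsertions-head r u∈ of λ { (v , refl) → refl }))) ⟩
  φ (true ∷ pinBits n (y ∷ z ∷ r)) + (φ (true ∷ pinBits n (z ∷ r)) +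
    ∑[ u ← innerInsertions n (z ∷ r) ] φ (markPeak x y z (pinBits (suc n) (y ∷ u)))) ∎
  where open ≡-Reasoning

-- A gap next to a pinnacle destroys it, any other gap only adds the new
-- maximum.  There are length w - 1 - 2 |Pin w| gaps of the second kind;
-- moving terms to the left avoids subtraction.
∑-innerInsertions : ∀ n w → Unique w → All (_< n) w → length w > 0 → (φ : List Bool → ℕ) →
  ∑[ u ← innerInsertions n w ] φ (pinBits (suc n) u) + (1 + 2 * trues (pinBits n w)) * φ (true ∷ pinBits n w) ≡
  length w * φ (true ∷ pinBits n w) + 2 * ∑[ v ← flops (pinBits n w) ] φ (true ∷ v)
∑-innerInsertions n (x ∷ []) _ _ _ φ
  rewrite trues-replicate n | flops-replicate n = sym (+-identityʳ (1 * φ (true ∷ replicate n false)))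
∑-innerInsertions n (x ∷ y ∷ []) _ (x<n ∷ y<n ∷ []) _ φ
  rewrite trues-replicate n | flops-replicate n | pinBits-max n x y [] (x<n ∷ y<n ∷ []) = two (φ (true ∷ replicate n false))
  where
  two : ∀ a → a + 0 + 1 * a ≡ 2 * a + 0
  two = solve-∀
∑-innerInsertions n (x ∷ w@(y ∷ z ∷ r)) (_ ∷ w!@(y∉ ∷ _)) xw<n@(x<n ∷ w<n@(y<n ∷ zr<n@(z<n ∷ _))) _ φ =
  step (isPeak? x y z) (∑-innerInsertions n w w! w<n z<s)
  where
  open ≡-Reasoning
  P = pinBits n (y ∷ z ∷ r)
  Z = pinBits n (z ∷ r)
  l = length (y ∷ z ∷ r)
  inner = innerInsertions n (z ∷ r)
  Identity : List Bool → ℕ → ℕ → (List Bool → ℕ) → Set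
  Identity v s m φ = s + (1 + 2 * trues v) * φ (true ∷ v) ≡ m * φ (true ∷ v) + 2 * ∑[ u ← flops v ] φ (true ∷ u)
  S = ∑[ u ← innerInsertions n (x ∷ y ∷ z ∷ r) ] φ (pinBits (suc n) u)

  step : Dec (x < y × z < y) →
    (∀ ψ → Identity P (∑[ u ← innerInsertions n (y ∷ z ∷ r) ] ψ (pinBits (suc n) u)) l ψ) →
    Identity (markPeak x y z P) S (suc l) φ
  -- No mark is added by `x`, and the only new gap, between `x` and `y`, destroys nothing: both
  -- sides gain one `φ (true ∷ P)`.
  step (no ¬peak) ih = subst (λ v → Identity v S (suc l) φ) (sym (markPeak-no P ¬peak)) (begin
    S + (1 + 2 * trues P) * φ (true ∷ P)
      ≡⟨ cong (_+ (1 + 2 * trues P) * φ (true ∷ P)) (begin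
           S
             ≡⟨ ∑-innerInsertions-∷∷∷ n x y z r xw<n φ ⟩
           φ (true ∷ P) + (φ (true ∷ Z) + ∑[ u ← inner ] φ (markPeak x y z (pinBits (suc n) (y ∷ u))))
             ≡⟨ cong (λ t → φ (true ∷ P) + (φ (true ∷ Z) + t)) (∑-cong inner λ u → cong φ (markPeak-no _ ¬peak)) ⟩
           φ (true ∷ P) + (φ (true ∷ Z) + ∑[ u ← inner ] φ (pinBits (suc n) (y ∷ u)))
             ≡⟨ cong (φ (true ∷ P) +_) (∑-innerInsertions-∷∷ n y z r w<n φ) ⟨
           φ (true ∷ P) + T ∎) ⟩
    φ (true ∷ P) + T + (1 + 2 * trues P) * φ (true ∷ P)
      ≡⟨ +-assoc (φ (true ∷ P)) T _ ⟩
    φ (true ∷ P) + (T + (1 + 2 * trues P) * φ (true ∷ P))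
      ≡⟨ cong (φ (true ∷ P) +_) (ih φ) ⟩
    φ (true ∷ P) + (l * φ (true ∷ P) + 2 * ∑[ v ← flops P ] φ (true ∷ v))
      ≡⟨ +-assoc (φ (true ∷ P)) (l * φ (true ∷ P)) _ ⟨
    suc l * φ (true ∷ P) + 2 * ∑[ v ← flops P ] φ (true ∷ v) ∎)
    where
    T = ∑[ u ← innerInsertions n (y ∷ z ∷ r) ] φ (pinBits (suc n) u)
  -- Both gaps beside the pinnacle `y` yield the set `P` without it; for the right one this uses
  -- that `Z` equals `P`, as `z < y`. Every other gap keeps the mark of `y`, so the induction
  -- hypothesis is taken at `φ ∘ mark y`, which is why `φ` has to be arbitrary.
  step (yes peak@(x<y , z<y)) ih = subst (λ v → Identity v S (suc l) φ) (sym (markPeak-yes P x<y z<y)) (begin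
    S + (1 + 2 * trues M) * φ (true ∷ M)
      ≡⟨ cong₂ (λ s t → s + (1 + 2 * t) * φ (true ∷ M))
           (begin
             S
               ≡⟨ ∑-innerInsertions-∷∷∷ n x y z r xw<n φ ⟩
             φ (true ∷ P) + (φ (true ∷ Z) + ∑[ u ← inner ] φ (markPeak x y z (pinBits (suc n) (y ∷ u))))
               ≡⟨ cong₂ (λ v t → φ (true ∷ P) + (φ (true ∷ v) + t)) (sym (pinBits-descent n y z r z<y))
                    (∑-cong inner λ u → cong φ (markPeak-yes _ x<y z<y)) ⟩
             φ (true ∷ P) + (φ (true ∷ P) + T) ∎)
           (trues-mark unset) ⟩
    φ (true ∷ P) + (φ (true ∷ P) + T) + (1 + 2 * suc (trues P)) * φ (true ∷ M)
      ≡⟨ lhs (φ (true ∷ P)) T (trues P) (φ (true ∷ M)) ⟩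
    2 * φ (true ∷ P) + φ (true ∷ M) + (φ (true ∷ M) + T + (1 + 2 * trues P) * φ (true ∷ M))
      ≡⟨ cong (2 * φ (true ∷ P) + φ (true ∷ M) +_) ih′ ⟩
    2 * φ (true ∷ P) + φ (true ∷ M) + (l * φ (true ∷ M) + 2 * ∑[ v ← flops P ] φ (true ∷ mark y v))
      ≡⟨ rhs (φ (true ∷ P)) (φ (true ∷ M)) l _ ⟩
    suc l * φ (true ∷ M) + 2 * (φ (true ∷ P) + ∑[ v ← flops P ] φ (true ∷ mark y v))
      ≡⟨ cong (λ t → suc l * φ (true ∷ M) + 2 * t) (flops-mark unset (φ ∘ (true ∷_))) ⟨
    suc l * φ (true ∷ M) + 2 * ∑[ v ← flops M ] φ (true ∷ v) ∎)
    where
    M = mark y P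
    T = ∑[ u ← inner ] φ (mark y (pinBits (suc n) (y ∷ u)))
    unset : Unset y P
    unset = unset-pinBits-head (z ∷ r) y<n (All.All¬⇒¬Any y∉)
    mark-true∷ : ∀ v → length v ≡ n → φ (mark y (true ∷ v)) ≡ φ (true ∷ mark y v)
    mark-true∷ v ∣v∣ = cong φ (mark-∷ v (λ y≡ → <⇒≢ y<n (≡-trans y≡ ∣v∣)))
    ih′ : φ (true ∷ M) + T + (1 + 2 * trues P) * φ (true ∷ M) ≡
          l * φ (true ∷ M) + 2 * ∑[ v ← flops P ] φ (true ∷ mark y v)
    ih′ = begin
      φ (true ∷ M) + T + (1 + 2 * trues P) * φ (true ∷ M)
        ≡⟨ cong (λ a → a + T + (1 + 2 * trues P) * a) (mark-true∷ P (length-pinBits n w)) ⟨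
      φ (mark y (true ∷ P)) + T + (1 + 2 * trues P) * φ (mark y (true ∷ P))
        ≡⟨ cong (_+ (1 + 2 * trues P) * φ (mark y (true ∷ P))) (≡-trans
             (∑-innerInsertions-∷∷ n y z r w<n (φ ∘ mark y))
             (cong (λ v → φ (mark y (true ∷ v)) + T) (sym (pinBits-descent n y z r z<y)))) ⟨
      ∑[ u ← innerInsertions n (y ∷ z ∷ r) ] φ (mark y (pinBits (suc n) u)) + (1 + 2 * trues P) * φ (mark y (true ∷ P))
        ≡⟨ ih (φ ∘ mark y) ⟩
      l * φ (mark y (true ∷ P)) + 2 * ∑[ v ← flops P ] φ (mark y (true ∷ v))
        ≡⟨ cong₂ (λ a t → l * a + 2 * t) (mark-true∷ P (length-pinBits n w))
             (∑-cong-∈ (flops P) λ {v} v∈ → mark-true∷ v (≡-trans (length-flops P v∈) (length-pinBits n w))) ⟩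
      l * φ (true ∷ M) + 2 * ∑[ v ← flops P ] φ (true ∷ mark y v) ∎
    lhs : ∀ p T q m → p + (p + T) + (1 + 2 * suc q) * m ≡ 2 * p + m + (m + T + (1 + 2 * q) * m)
    lhs = solve-∀
    rhs : ∀ p m l s → 2 * p + m + (l * m + 2 * s) ≡ suc l * m + 2 * (p + s)
    rhs = solve-∀

-- The recurrence in n

count : ℕ → List Bool → ℕ
count n r = ∑[ w ← permutations n ] 𝟙 (pinBits n w ≟ˡ r)

module _ {n w} (σ : w ↭ downFrom (suc n)) where

  private
    w! : Unique w
    w! = AllPairs-resp-↭ ≢-sym (↭-sym σ) (Unique.downFrom⁺ (suc n))

    w< : All (_< suc n) w
    w< = All.tabulate (λ x∈ → ∈-downFrom⁻ (∈-resp-↭ σ x∈))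

    ∣w∣ : length w ≡ suc n
    ∣w∣ = ≡-trans (↭-length σ) (length-downFrom (suc n))

    P : List Bool
    P = pinBits (suc n) w

  ∑-insertions-pinBits : (φ : List Bool → ℕ) →
    ∑[ u ← insertions (suc n) w ] φ (pinBits (suc (suc n)) u) + (1 + 2 * trues P) * φ (true ∷ P) ≡
    2 * φ (false ∷ P) + (suc n * φ (true ∷ P) + 2 * ∑[ v ← flops P ] φ (true ∷ v))
  ∑-insertions-pinBits φ = go w w! w< ∣w∣
    where
    open ≡-Reasoning
    N = suc n
    go : ∀ w → Unique w → All (_< N) w → length w ≡ N → let Q = pinBits N w in
      ∑[ u ← insertions N w ] φ (pinBits (suc N) u) + (1 + 2 * trues Q) * φ (true ∷ Q) ≡
      2 * φ (false ∷ Q) + (N * φ (true ∷ Q) + 2 * ∑[ v ← flops Q ] φ (true ∷ v))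
    go w@(x ∷ w′) w! w< ∣w∣ = begin
      ∑[ u ← insertions N w ] φ (pinBits (suc N) u) + R
        ≡⟨ cong (_+ R) (∑-insertions N x w′ (φ ∘ pinBits (suc N))) ⟩
      φ (pinBits (suc N) (N ∷ w)) + φ (pinBits (suc N) (w ++ [ N ])) + S + R
        ≡⟨ cong₂ (λ u v → φ u + φ v + S + R) (pinBits-max∷ N w w<) (pinBits-∷ʳmax N w w<) ⟩
      φ (false ∷ Q) + φ (false ∷ Q) + S + R
        ≡⟨ regroup (φ (false ∷ Q)) S R ⟩
      2 * φ (false ∷ Q) + (S + R)
        ≡⟨ cong (2 * φ (false ∷ Q) +_) (∑-innerInsertions N w w! w< z<s φ) ⟩
      2 * φ (false ∷ Q) + (length w * φ (true ∷ Q) + 2 * ∑[ v ← flops Q ] φ (true ∷ v))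
        ≡⟨ cong (λ l → 2 * φ (false ∷ Q) + (l * φ (true ∷ Q) + 2 * ∑[ v ← flops Q ] φ (true ∷ v))) ∣w∣ ⟩
      2 * φ (false ∷ Q) + (N * φ (true ∷ Q) + 2 * ∑[ v ← flops Q ] φ (true ∷ v)) ∎
      where
      Q = pinBits N w
      R = (1 + 2 * trues Q) * φ (true ∷ Q)
      S = ∑[ u ← innerInsertions N w ] φ (pinBits (suc N) u)
      regroup : ∀ a s r → a + a + s + r ≡ 2 * a + (s + r)
      regroup = solve-∀

  insertions-false : ∀ r →
    ∑[ u ← insertions (suc n) w ] 𝟙 (pinBits (suc (suc n)) u ≟ˡ false ∷ r) ≡ 2 * 𝟙 (P ≟ˡ r)
  insertions-false r = begin
    S                                       ≡⟨ +-identityʳ S ⟨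
    S + 0                                   ≡⟨ cong (S +_) (*-zeroʳ (1 + 2 * trues P)) ⟨
    S + (1 + 2 * trues P) * 0               ≡⟨ ∑-insertions-pinBits (λ v → 𝟙 (v ≟ˡ false ∷ r)) ⟩
    2 * 𝟙 (P ≟ˡ r) + (suc n * 0 + 2 * ∑[ _ ← flops P ] 0)
                                            ≡⟨ cong₂ (λ s t → 2 * 𝟙 (P ≟ˡ r) + (s + 2 * t)) (*-zeroʳ (suc n)) (∑-zero (flops P)) ⟩
    2 * 𝟙 (P ≟ˡ r) + 0                      ≡⟨ +-identityʳ _ ⟩
    2 * 𝟙 (P ≟ˡ r) ∎
    where
    open ≡-Reasoning
    S = ∑[ u ← insertions (suc n) w ] 𝟙 (pinBits (suc (suc n)) u ≟ˡ false ∷ r)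

  insertions-true : ∀ r →
    ∑[ u ← insertions (suc n) w ] 𝟙 (pinBits (suc (suc n)) u ≟ˡ true ∷ r) + (1 + 2 * trues r) * 𝟙 (P ≟ˡ r) ≡
    suc n * 𝟙 (P ≟ˡ r) + 2 * ∑[ s ← flips r ] 𝟙 (P ≟ˡ s)
  insertions-true r = begin
    S + (1 + 2 * trues r) * 𝟙 (P ≟ˡ r)                          ≡⟨ cong (S +_) (same (P ≟ˡ r)) ⟨
    S + (1 + 2 * trues P) * 𝟙 (P ≟ˡ r)                          ≡⟨ ∑-insertions-pinBits (λ v → 𝟙 (v ≟ˡ true ∷ r)) ⟩
    suc n * 𝟙 (P ≟ˡ r) + 2 * ∑[ v ← flops P ] 𝟙 (v ≟ˡ r)        ≡⟨ cong (λ t → suc n * 𝟙 (P ≟ˡ r) + 2 * t) (flops-flips P r) ⟩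
    suc n * 𝟙 (P ≟ˡ r) + 2 * ∑[ s ← flips r ] 𝟙 (P ≟ˡ s) ∎
    where
    open ≡-Reasoning
    S = ∑[ u ← insertions (suc n) w ] 𝟙 (pinBits (suc (suc n)) u ≟ˡ true ∷ r)
    -- The coefficient depends on the word through `P`. Where the indicator is nonzero, `P` is `r`,
    -- so the coefficient becomes constant and can leave the sum over all words.
    same : (P≟r : Dec (P ≡ r)) → (1 + 2 * trues P) * 𝟙 P≟r ≡ (1 + 2 * trues r) * 𝟙 P≟r
    same (yes P≡r) = cong (λ v → (1 + 2 * trues v) * 1) P≡r
    same (no _)    = ≡-trans (*-zeroʳ (1 + 2 * trues P)) (sym (*-zeroʳ (1 + 2 * trues r)))

-- The old word must be nonempty: the empty word has one gap rather than two distinct ends. Hence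
-- the recurrence, and the comparison with `H`, start at length 1.
count-false : ∀ n r → count (suc (suc n)) (false ∷ r) ≡ 2 * count (suc n) r
count-false n r = begin
  ∑[ u ← permutations (suc (suc n)) ] 𝟙 (pinBits (suc (suc n)) u ≟ˡ false ∷ r)
    ≡⟨ ∑-concatMap (insertions (suc n)) (permutations (suc n)) ⟩
  ∑[ w ← permutations (suc n) ] ∑[ u ← insertions (suc n) w ] 𝟙 (pinBits (suc (suc n)) u ≟ˡ false ∷ r)
    ≡⟨ ∑-cong-∈ (permutations (suc n)) (λ w∈ → insertions-false (∈-permutations⁻ (suc n) w∈) r) ⟩
  ∑[ w ← permutations (suc n) ] (2 * 𝟙 (pinBits (suc n) w ≟ˡ r))
    ≡⟨ ∑-*ˡ 2 (permutations (suc n)) ⟩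
  2 * count (suc n) r ∎
  where open ≡-Reasoning

count-true : ∀ n r →
  count (suc (suc n)) (true ∷ r) + (1 + 2 * trues r) * count (suc n) r ≡
  suc n * count (suc n) r + 2 * ∑[ s ← flips r ] count (suc n) s
count-true n r = begin
  count (suc (suc n)) (true ∷ r) + (1 + 2 * trues r) * count (suc n) r
    ≡⟨ cong₂ _+_ (∑-concatMap (insertions (suc n)) ws) (sym (∑-*ˡ (1 + 2 * trues r) ws)) ⟩
  (∑[ w ← ws ] ∑[ u ← insertions (suc n) w ] 𝟙 (pinBits (suc (suc n)) u ≟ˡ true ∷ r)) +
  (∑[ w ← ws ] ((1 + 2 * trues r) * 𝟙 (pinBits (suc n) w ≟ˡ r)))
    ≡⟨ ∑-+ ws ⟨
  ∑[ w ← ws ] (∑[ u ← insertions (suc n) w ] 𝟙 (pinBits (suc (suc n)) u ≟ˡ true ∷ r) +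
    (1 + 2 * trues r) * 𝟙 (pinBits (suc n) w ≟ˡ r))
    ≡⟨ ∑-cong-∈ ws (λ w∈ → insertions-true (∈-permutations⁻ (suc n) w∈) r) ⟩
  ∑[ w ← ws ] (suc n * 𝟙 (pinBits (suc n) w ≟ˡ r) + 2 * ∑[ s ← flips r ] 𝟙 (pinBits (suc n) w ≟ˡ s))
    ≡⟨ ∑-+ ws ⟩
  (∑[ w ← ws ] (suc n * 𝟙 (pinBits (suc n) w ≟ˡ r))) +
  (∑[ w ← ws ] (2 * ∑[ s ← flips r ] 𝟙 (pinBits (suc n) w ≟ˡ s)))
    ≡⟨ cong₂ _+_ (∑-*ˡ (suc n) ws)
         (≡-trans (∑-*ˡ 2 ws) (cong (2 *_) (∑-swap ws (flips r)))) ⟩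
  suc n * count (suc n) r + 2 * ∑[ s ← flips r ] count (suc n) s ∎
  where
  open ≡-Reasoning
  ws = permutations (suc n)

-- The induction runs over all `r` of a given length at once, since the pinnacle case calls on every
-- flip of the tail.
count≡H : ∀ n r → length r ≡ suc n → count (suc n) r ≡ H 1 r
count≡H zero    (false ∷ []) _ = refl
count≡H zero    (true  ∷ []) _ = refl
count≡H (suc n) (false ∷ r@(b ∷ r′)) ∣r∣ = begin
  count (suc (suc n)) (false ∷ r)   ≡⟨ count-false n r ⟩
  2 * count (suc n) r               ≡⟨ cong (2 *_) (count≡H n r (suc-injective ∣r∣)) ⟩
  -- A single segment cannot have been opened last when smaller values are present, so the opening
  -- term vanishes.
  2 * H 1 r                         ≡⟨ cong (_+ 2 * H 1 r) (H-zero b r′) ⟨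
  H 0 r + 2 * H 1 r ∎
  where open ≡-Reasoning
-- The negative term of the recurrence is added to both sides and cancelled at the end; `2 * H 2 r`
-- is `H 1 (true ∷ r)`.
count≡H (suc n) (true  ∷ r) ∣r∣ = +-cancelʳ-≡ ((1 + 2 * trues r) * H 1 r) _ _ (begin
  count (suc (suc n)) (true ∷ r) + (1 + 2 * trues r) * H 1 r
    ≡⟨ cong (λ t → count (suc (suc n)) (true ∷ r) + (1 + 2 * trues r) * t) (count≡H n r (suc-injective ∣r∣)) ⟨
  count (suc (suc n)) (true ∷ r) + (1 + 2 * trues r) * count (suc n) r
    ≡⟨ count-true n r ⟩
  suc n * count (suc n) r + 2 * ∑[ s ← flips r ] count (suc n) s
    ≡⟨ cong₂ (λ s t → suc n * s + 2 * t) (count≡H n r (suc-injective ∣r∣))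
         (∑-cong-∈ (flips r) λ {s} s∈ → count≡H n s (≡-trans (length-flips r s∈) (suc-injective ∣r∣))) ⟩
  suc n * H 1 r + 2 * ∑ (flips r) (H 1)
    ≡⟨ cong (λ l → l * H 1 r + 2 * ∑ (flips r) (H 1)) (suc-injective ∣r∣) ⟨
  length r * H 1 r + 2 * ∑ (flips r) (H 1)
    ≡⟨ H-flips 1 r ⟨
  2 * H 2 r + (1 + 2 * trues r) * H 1 r ∎)
  where open ≡-Reasoning

-- Words of permutations

word : ∀ {n m} → Vec (Fin n) m → List ℕ
word w = tabulate (toℕ ∘ lookup w)

word-injective : ∀ {n m} {v w : Vec (Fin n) m} → word v ≡ word w → v ≡ w
word-injective {v = []}    {[]}    _  = refl
word-injective {v = x ∷ v} {y ∷ w} eq =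
  cong₂ _∷_ (toℕ-injective (∷-injectiveˡ eq)) (word-injective (∷-injectiveʳ eq))

word-surjective : ∀ {n} m {v} → All (_< n) v → length v ≡ m → ∃[ w ] word {n} {m} w ≡ v
word-surjective zero    {[]}    []          _   = [] , refl
word-surjective (suc m) {x ∷ v} (x<n ∷ v<n) ∣v∣ =
  let (w , eq) = word-surjective m v<n (suc-injective ∣v∣)
  in fromℕ< x<n ∷ w , cong₂ _∷_ (toℕ-fromℕ< x<n) eq

tabulate-unique⁻ : ∀ {A : Set} {n} {f : Fin n → A} → Unique (tabulate f) → Injective _≡_ _≡_ f
tabulate-unique⁻ (f₀∉ ∷ _) {zero}  {zero}  eq = refl
tabulate-unique⁻ (f₀∉ ∷ _) {zero}  {suc j} eq = contradiction eq (All.tabulate⁻ f₀∉ j)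
tabulate-unique⁻ (f₀∉ ∷ _) {suc i} {zero}  eq = contradiction (sym eq) (All.tabulate⁻ f₀∉ i)
tabulate-unique⁻ (_ ∷ f!)  {suc i} {suc j} eq = cong suc (tabulate-unique⁻ f! eq)

isPermutation⇔ : ∀ {n} (w : Vec (Fin n) n) → IsPermutation w ⇔ (word w ↭ downFrom n)
isPermutation⇔ {n} w = mk⇔ to from
  where
  to : IsPermutation w → word w ↭ downFrom n
  to (inj , sur) = ∼bag⇒↭ (unique∧set⇒bag (Unique.tabulate⁺ (inj ∘ toℕ-injective)) (Unique.downFrom⁺ n)
    (mk⇔ (λ k∈ → let (i , eq) = ∈-tabulate⁻ k∈ in ∈-downFrom⁺ (subst (_< n) (sym eq) (toℕ<n (lookup w i))))
         (λ k∈ → let k<n = ∈-downFrom⁻ k∈ ; (i , eq) = sur (fromℕ< k<n) in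
           subst (_∈ word w) (≡-trans (cong toℕ (eq refl)) (toℕ-fromℕ< k<n)) (∈-tabulate⁺ i))))
  from : word w ↭ downFrom n → IsPermutation w
  from σ = (λ eq → tabulate-unique⁻ (AllPairs-resp-↭ ≢-sym (↭-sym σ) (Unique.downFrom⁺ n)) (cong toℕ eq)) ,
    λ v → let (i , eq) = ∈-tabulate⁻ (∈-resp-↭ (↭-sym σ) (∈-downFrom⁺ (toℕ<n v)))
          in i , λ { refl → toℕ-injective (sym eq) }

∈-vectors : ∀ {n m} (w : Vec (Fin n) m) → w ∈ vectors (allFin n) m
∈-vectors []      = here refl
∈-vectors (x ∷ w) = ∈-cartesianProductWith⁺ _∷_ (∈-allFin x) (∈-vectors w)

vectors-unique : ∀ n m → Unique (vectors (allFin n) m)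
vectors-unique n zero    = [] ∷ []
vectors-unique n (suc m) = Unique.cartesianProductWith⁺ _∷_ Vec.∷-injective (Unique.allFin⁺ n) (vectors-unique n m)

-- Both lists are free of repetitions and have the same members, so the sum defining `p` may be
-- taken over the enumeration by insertion.
words↭permutations : ∀ n → map word (filter isPermutation? (vectors (allFin n) n)) ↭ permutations n
words↭permutations n = ∼bag⇒↭ (unique∧set⇒bag
  (Unique.map⁺ word-injective (Unique.filter⁺ isPermutation? (vectors-unique n n)))
  (permutations-unique n)
  (mk⇔
    (λ v∈ → let (w , _ , eq , perm) = ∈-map∘filter⁻ word isPermutation? {word} {vectors (allFin n) n} v∈ in
      ∈-permutations⁺ n (subst (_↭ downFrom n) (sym eq) (Equivalence.to (isPermutation⇔ w) perm)))
    (λ v∈ → let σ = ∈-permutations⁻ n v∈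
                (w , eq) = word-surjective n
                  (All.tabulate λ k∈ → ∈-downFrom⁻ (∈-resp-↭ σ k∈))
                  (≡-trans (↭-length σ) (length-downFrom n))
            in ∈-map∘filter⁺ word isPermutation? {word} {vectors (allFin n) n} (w , ∈-vectors w , sym eq ,
                 Equivalence.from (isPermutation⇔ w) (subst (_↭ downFrom n) (sym eq) σ)))))

-- Pinnacles of a word

-- A bridge between `pinBits` and `IsPinnacle`: it scans triples like the former and speaks of a
-- single value like the latter.
Peak : ℕ → List ℕ → Set
Peak k (x ∷ w@(y ∷ z ∷ _)) = (k ≡ y × x < y × z < y) ⊎ Peak k w
Peak k _                   = ⊥

peak? : ∀ k w → Dec (Peak k w)
peak? k []                  = no λ ()
peak? k (x ∷ [])            = no λ ()
peak? k (x ∷ y ∷ [])        = no λ ()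
peak? k (x ∷ w@(y ∷ z ∷ _)) = (k ≟ y ×-dec isPeak? x y z) ⊎-dec peak? k w

applyDownFrom-cong : ∀ {A : Set} {f g : ℕ → A} n → (∀ k → k < n → f k ≡ g k) →
  applyDownFrom f n ≡ applyDownFrom g n
applyDownFrom-cong zero    f≗g = refl
applyDownFrom-cong (suc n) f≗g =
  cong₂ _∷_ (f≗g n (n<1+n n)) (applyDownFrom-cong n λ k k<n → f≗g k (m<n⇒m<1+n k<n))

applyDownFrom-false : ∀ n → applyDownFrom (λ _ → false) n ≡ replicate n false
applyDownFrom-false zero    = refl
applyDownFrom-false (suc n) = cong (false ∷_) (applyDownFrom-false n)

mark-applyDownFrom : ∀ j (f : ℕ → Bool) n →
  mark j (applyDownFrom f n) ≡ applyDownFrom (λ k → does (k ≟ j) ∨ f k) n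
mark-applyDownFrom j f zero    = refl
mark-applyDownFrom j f (suc n) with j ≟ n
... | yes refl = ≡-trans (mark-top (applyDownFrom f n) (sym (length-applyDownFrom f n)))
  (cong₂ _∷_ (sym (cong (_∨ f n) (dec-true (n ≟ n) refl)))
    (applyDownFrom-cong n λ k k<n → sym (cong (_∨ f k) (dec-false (k ≟ n) (<⇒≢ k<n)))))
... | no j≢n = ≡-trans (mark-∷ (applyDownFrom f n) (λ eq → j≢n (≡-trans eq (length-applyDownFrom f n))))
  (cong₂ _∷_ (sym (cong (_∨ f n) (dec-false (n ≟ j) (≢-sym j≢n)))) (mark-applyDownFrom j f n))

markPeak-applyDownFrom : ∀ x y z (f : ℕ → Bool) n →
  markPeak x y z (applyDownFrom f n) ≡ applyDownFrom (λ k → does (k ≟ y) ∧ does (isPeak? x y z) ∨ f k) n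
markPeak-applyDownFrom x y z f n with does (isPeak? x y z)
... | true  = ≡-trans (mark-applyDownFrom y f n)
  (applyDownFrom-cong n λ k _ → cong (_∨ f k) (sym (∧-identityʳ (does (k ≟ y)))))
... | false = applyDownFrom-cong n λ k _ → cong (_∨ f k) (sym (∧-zeroʳ (does (k ≟ y))))

pinBits-peak? : ∀ n w → pinBits n w ≡ applyDownFrom (λ k → does (peak? k w)) n
pinBits-peak? n []                  = sym (applyDownFrom-false n)
pinBits-peak? n (x ∷ [])            = sym (applyDownFrom-false n)
pinBits-peak? n (x ∷ y ∷ [])        = sym (applyDownFrom-false n)
pinBits-peak? n (x ∷ w@(y ∷ z ∷ _)) = ≡-trans (cong (markPeak x y z) (pinBits-peak? n w))
  (markPeak-applyDownFrom x y z (λ k → does (peak? k w)) n)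

peak⁺ : ∀ {n m} (w : Vec (Fin n) m) h i j → toℕ i ≡ suc (toℕ h) → toℕ j ≡ suc (toℕ i) →
  toℕ (lookup w h) < toℕ (lookup w i) → toℕ (lookup w j) < toℕ (lookup w i) →
  Peak (toℕ (lookup w i)) (word w)
peak⁺ (x ∷ y ∷ z ∷ w) zero    (suc zero) (suc (suc zero)) refl refl x<y z<y = inj₁ (refl , x<y , z<y)
peak⁺ (x ∷ y ∷ z ∷ w) (suc h) (suc i)    (suc j)          i≡ j≡ x<y z<y =
  inj₂ (peak⁺ (y ∷ z ∷ w) h i j (suc-injective i≡) (suc-injective j≡) x<y z<y)
peak⁺ (x ∷ y ∷ [])    zero    (suc zero) (suc zero)       refl () x<y z<y
peak⁺ (x ∷ y ∷ [])    (suc zero) (suc zero) _             () _ x<y z<y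

peak⁻ : ∀ {n m} (w : Vec (Fin n) m) k → Peak k (word w) →
  ∃[ h ] ∃[ i ] ∃[ j ] (toℕ i ≡ suc (toℕ h) × toℕ j ≡ suc (toℕ i) ×
    toℕ (lookup w i) ≡ k × toℕ (lookup w h) < toℕ (lookup w i) × toℕ (lookup w j) < toℕ (lookup w i))
peak⁻ (x ∷ y ∷ z ∷ w) k (inj₁ (k≡y , x<y , z<y)) =
  zero , suc zero , suc (suc zero) , refl , refl , sym k≡y , x<y , z<y
peak⁻ (x ∷ y ∷ z ∷ w) k (inj₂ peak) =
  let (h , i , j , i≡ , j≡ , rest) = peak⁻ (y ∷ z ∷ w) k peak
  in suc h , suc i , suc j , cong suc i≡ , cong suc j≡ , rest

isPinnacle⇔ : ∀ {n} (w : Vec (Fin n) n) v → IsPinnacle w v ⇔ Peak (toℕ v) (word w)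
isPinnacle⇔ w v = mk⇔
  (λ (h , i , j , i≡ , j≡ , wi≡v , x<y , z<y) →
    subst (λ u → Peak (toℕ u) (word w)) wi≡v (peak⁺ w h i j i≡ j≡ x<y z<y))
  (λ peak → let (h , i , j , i≡ , j≡ , wi≡v , lt) = peak⁻ w (toℕ v) peak
            in h , i , j , i≡ , j≡ , toℕ-injective wi≡v , lt)

-- Subsets of [n] as bit lists

-- Total on ℕ and false from `n` on, so that subsets of different ambient sets become comparable
-- functions.
member : ∀ {n} → Subset n → ℕ → Bool
member []      _       = false
member (b ∷ S) zero    = b
member (b ∷ S) (suc k) = member S k

bits : ∀ {n} → Subset n → List Bool
bits {n} S = applyDownFrom (member S) n

-- A subset lists its smallest value first, a bit list its largest; hence the new bit goes to the
-- far end.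
bits-∷ : ∀ {n} b (S : Subset n) → bits (b ∷ S) ≡ bits S ∷ʳ b
bits-∷ {n} b S = sym (applyDownFrom-∷ʳ (member (b ∷ S)) n)

bits-injective : ∀ {n} {S T : Subset n} → bits S ≡ bits T → S ≡ T
bits-injective {S = []}    {[]}    _  = refl
bits-injective {S = b ∷ S} {c ∷ T} eq =
  let (S≡T , b≡c) = ∷ʳ-injective (bits S) (bits T) (≡-trans (sym (bits-∷ b S)) (≡-trans eq (bits-∷ c T)))
  in cong₂ _∷_ b≡c (bits-injective S≡T)

length-∷ʳ : ∀ {A : Set} (xs : List A) x → length (xs ∷ʳ x) ≡ suc (length xs)
length-∷ʳ xs x = ≡-trans (length-++ xs) (+-comm (length xs) 1)

bits-surjective : ∀ {n} r → length r ≡ n → ∃[ S ] bits {n} S ≡ r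
bits-surjective {zero}  []  _   = [] , refl
bits-surjective {suc n} r   ∣r∣ with initLast r
... | []      = case ∣r∣ of λ ()
... | s ∷ʳ′ b =
  let (S , eq) = bits-surjective s (suc-injective (≡-trans (sym (length-∷ʳ s b)) ∣r∣))
  in b ∷ S , ≡-trans (bits-∷ b S) (cong (_∷ʳ b) eq)

trues-∷ʳ : ∀ r b → trues (r ∷ʳ b) ≡ trues (b ∷ r)
trues-∷ʳ []          b     = refl
trues-∷ʳ (false ∷ r) true  = trues-∷ʳ r true
trues-∷ʳ (false ∷ r) false = trues-∷ʳ r false
trues-∷ʳ (true  ∷ r) true  = cong suc (trues-∷ʳ r true)
trues-∷ʳ (true  ∷ r) false = cong suc (trues-∷ʳ r false)

trues-bits : ∀ {n} (S : Subset n) → trues (bits S) ≡ ∣ S ∣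
trues-bits []          = refl
trues-bits (b ∷ S) = ≡-trans (cong trues (bits-∷ b S)) (≡-trans (trues-∷ʳ (bits S) b) (step b))
  where
  step : ∀ b → trues (b ∷ bits S) ≡ ∣ b ∷ S ∣
  step true  = cong suc (trues-bits S)
  step false = trues-bits S

member-toℕ : ∀ {n} (S : Subset n) i → member S (toℕ i) ≡ lookup S i
member-toℕ (b ∷ S) zero    = refl
member-toℕ (b ∷ S) (suc i) = member-toℕ S i

member-≥ : ∀ {n} (S : Subset n) k → n ≤ k → member S k ≡ false
member-≥ []      k       _         = refl
member-≥ (b ∷ S) (suc k) (s≤s n≤k) = member-≥ S k n≤k

bits-Pin : ∀ {n} (w : Vec (Fin n) n) → pinBits n (word w) ≡ bits (Pin w)
bits-Pin {n} w = ≡-trans (pinBits-peak? n (word w)) (applyDownFrom-cong n λ k k<n →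
  let v = fromℕ< k<n in begin
  does (peak? k (word w))          ≡⟨ cong (λ j → does (peak? j (word w))) (toℕ-fromℕ< k<n) ⟨
  does (peak? (toℕ v) (word w))    ≡⟨ does-⇔ (isPinnacle⇔ w v) (isPinnacle? w v) (peak? (toℕ v) (word w)) ⟨
  does (isPinnacle? w v)           ≡⟨ Vec.lookup∘tabulate _ v ⟨
  lookup (Pin w) v                 ≡⟨ member-toℕ (Pin w) v ⟨
  member (Pin w) (toℕ v)           ≡⟨ cong (member (Pin w)) (toℕ-fromℕ< k<n) ⟩
  member (Pin w) k ∎)
  where open ≡-Reasoning

-- Counting by pinnacle set

length-filter-× : {A : Set} {R Q : A → Set} (R? : ∀ x → Dec (R x)) (Q? : ∀ x → Dec (Q x)) (xs : List A) →
  length (filter (λ x → R? x ×-dec Q? x) xs) ≡ ∑[ x ← filter R? xs ] 𝟙 (Q? x)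
length-filter-× R? Q? xs = begin
  length (filter (λ x → R? x ×-dec Q? x) xs)   ≡⟨ length-filter-∑ (λ x → R? x ×-dec Q? x) xs ⟩
  ∑[ x ← xs ] 𝟙 (R? x ×-dec Q? x)              ≡⟨ ∑-cong xs (λ x → 𝟙-× (R? x) (Q? x)) ⟩
  ∑[ x ← xs ] (𝟙 (R? x) * 𝟙 (Q? x))            ≡⟨ ∑-filter R? xs ⟩
  ∑[ x ← filter R? xs ] 𝟙 (Q? x) ∎
  where open ≡-Reasoning

Pin≟ : ∀ {n} (S : Subset n) w → Dec (Pin w ≡ S)
Pin≟ S w = Vec.≡-dec _≟ᵇ_ (Pin w) S

p≡count : ∀ n (S : Subset n) → p n S ≡ count n (bits S)
p≡count n S = ≡-trans
  (length-filter-× isPermutation? (Pin≟ S) (vectors (allFin n) n))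
  (onPermutations (filter isPermutation? (vectors (allFin n) n)) (words↭permutations n))
  where
  open ≡-Reasoning
  onPermutations : ∀ ws → map word ws ↭ permutations n → ∑[ w ← ws ] 𝟙 (Pin≟ S w) ≡ count n (bits S)
  onPermutations ws σ = begin
    ∑[ w ← ws ] 𝟙 (Pin≟ S w)
      ≡⟨ ∑-cong ws (λ w → 𝟙-⇔ (mk⇔
           (λ eq → ≡-trans (bits-Pin w) (cong bits eq))
           (λ eq → bits-injective (≡-trans (sym (bits-Pin w)) eq)))
           (Pin≟ S w) (pinBits n (word w) ≟ˡ bits S)) ⟩
    ∑[ w ← ws ] 𝟙 (pinBits n (word w) ≟ˡ bits S)
      ≡⟨ ∑-map word ws ⟨
    ∑[ v ← map word ws ] 𝟙 (pinBits n v ≟ˡ bits S)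
      ≡⟨ ∑-↭ σ ⟩
    count n (bits S) ∎

p≡H : ∀ n (S : Subset (suc n)) → p (suc n) S ≡ H 1 (bits S)
p≡H n S = ≡-trans (p≡count (suc n) S) (count≡H n (bits S) (length-applyDownFrom (member S) (suc n)))

length-filter>0⁺ : {A : Set} {R : A → Set} (R? : ∀ x → Dec (R x)) {xs : List A} {x : A} →
  x ∈ xs → R x → length (filter R? xs) > 0
length-filter>0⁺ R? x∈xs r = ∈-length (∈-filter⁺ R? x∈xs r)

length-filter>0⁻ : {A : Set} {R : A → Set} (R? : ∀ x → Dec (R x)) (xs : List A) →
  length (filter R? xs) > 0 → ∃[ x ] R x
length-filter>0⁻ R? xs pos with filter R? xs in eq
... | x ∷ _ = x , proj₂ (∈-filter⁻ R? {xs = xs} (subst (x ∈_) (sym eq) (here refl)))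

p>0 : ∀ {n} (w : Vec (Fin n) n) → IsPermutation w → p n (Pin w) > 0
p>0 w perm =
  length-filter>0⁺ (λ v → isPermutation? v ×-dec Pin≟ (Pin w) v) (∈-vectors w) (perm , refl)

p>0⇒admissible : ∀ {n} (S : Subset (suc n)) → p (suc n) S > 0 → Admissible S
p>0⇒admissible {n} S pos =
  let (w , perm , Pin≡S) = length-filter>0⁻ (λ v → isPermutation? v ×-dec Pin≟ S v) (vectors (allFin (suc n)) (suc n)) pos
  in suc n , s≤s z≤n , w , perm , λ m → subst (λ T → m ∈ᴺ S ⇔ m ∈ᴺ T) (sym Pin≡S) (mk⇔ id id)

-- Independence of the ambient set

H₁-false : ∀ (f : ℕ → Bool) m → f (suc m) ≡ false →
  H 1 (applyDownFrom f (suc (suc m))) ≡ 2 * H 1 (applyDownFrom f (suc m))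
H₁-false f m eq rewrite eq = cong (_+ 2 * H 1 (applyDownFrom f (suc m))) (H-zero (f m) (applyDownFrom f m))

-- A non-pinnacle above all other values goes to one of the two ends of the single segment.
H₁-extend : ∀ (f : ℕ → Bool) m t → (∀ j → m < j → f j ≡ false) →
  H 1 (applyDownFrom f (suc (t + m))) ≡ 2 ^ t * H 1 (applyDownFrom f (suc m))
H₁-extend f m zero    _  = sym (+-identityʳ _)
H₁-extend f m (suc t) f≡ = begin
  H 1 (applyDownFrom f (suc (suc (t + m))))      ≡⟨ H₁-false f (t + m) (f≡ (suc (t + m)) (s≤s (m≤n+m m t))) ⟩
  2 * H 1 (applyDownFrom f (suc (t + m)))        ≡⟨ cong (2 *_) (H₁-extend f m t f≡) ⟩
  2 * (2 ^ t * H 1 (applyDownFrom f (suc m)))    ≡⟨ *-assoc 2 (2 ^ t) _ ⟨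
  2 * 2 ^ t * H 1 (applyDownFrom f (suc m)) ∎
  where open ≡-Reasoning

-- The witness of admissibility may live in a smaller or a larger symmetric group than the one
-- considered. The values between the two sizes are not pinnacles, so the counts differ by a power
-- of 2.
H₁>0-stable : ∀ (f : ℕ → Bool) k n → (∀ j → k < j → f j ≡ false) → (∀ j → n < j → f j ≡ false) →
  H 1 (applyDownFrom f (suc k)) > 0 → H 1 (applyDownFrom f (suc n)) > 0
H₁>0-stable f k n fk fn pos with ≤-total k n
... | inj₁ k≤n = subst (_> 0) (≡-trans (sym (H₁-extend f k (n ∸ k) fk)) (cong (λ l → H 1 (applyDownFrom f (suc l))) (m∸n+n≡m k≤n)))
  (*-mono-≤ (m^n>0 2 (n ∸ k)) pos)
... | inj₂ n≤k = m*n>0 (2 ^ (k ∸ n))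
  (subst (_> 0) (≡-trans (cong (λ l → H 1 (applyDownFrom f (suc l))) (sym (m∸n+n≡m n≤k))) (H₁-extend f n (k ∸ n) fn)) pos)

member⇒∈ᴺ : ∀ {n} (S : Subset n) k → member S k ≡ true → suc k ∈ᴺ S
member⇒∈ᴺ (b ∷ S) zero    refl = zero , here , refl
member⇒∈ᴺ (b ∷ S) (suc k) eq   =
  let (i , i∈S , k≡) = member⇒∈ᴺ S k eq in suc i , there i∈S , cong suc k≡

∈ᴺ⇒member : ∀ {n} (S : Subset n) k → suc k ∈ᴺ S → member S k ≡ true
∈ᴺ⇒member S k (i , i∈S , refl) = ≡-trans (member-toℕ S i) (Vec.[]=⇒lookup i∈S)

member-cong : ∀ {n m} (S : Subset n) (T : Subset m) → (∀ k → k ∈ᴺ S ⇔ k ∈ᴺ T) → ∀ k → member S k ≡ member T k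
member-cong S T S⇔T k with member S k in eqS | member T k in eqT
... | true  | true  = refl
... | false | false = refl
... | true  | false = ≡-trans (sym (∈ᴺ⇒member T k (Equivalence.to (S⇔T (suc k)) (member⇒∈ᴺ S k eqS)))) eqT
... | false | true  = ≡-trans (sym eqS) (∈ᴺ⇒member S k (Equivalence.from (S⇔T (suc k)) (member⇒∈ᴺ T k eqT)))

admissible⇒H₁>0 : ∀ {n} (S : Subset (suc n)) → Admissible S → H 1 (bits S) > 0
admissible⇒H₁>0 {n} S (suc k , _ , w , perm , S⇔Pin) = H₁>0-stable (member S) k n
  (λ j k<j → ≡-trans (S≗Pin j) (member-≥ (Pin w) j k<j))
  (λ j n<j → member-≥ S j n<j)
  (subst (λ r → H 1 r > 0) (applyDownFrom-cong (suc k) λ j _ → sym (S≗Pin j))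
    (≤-trans (p>0 w perm) (≤-reflexive (p≡H k (Pin w)))))
  where
  S≗Pin : ∀ j → member S j ≡ member (Pin w) j
  S≗Pin = member-cong S (Pin w) S⇔Pin

-- The bounds

Bounds : ℕ → ℕ → ℕ → ℕ → Set
Bounds d n L U =
  ((S : Subset n) → Admissible S → ∣ S ∣ ≡ d → L ≤ p n S × p n S ≤ U) ×
  (∃[ S ] (Admissible {n} S × ∣ S ∣ ≡ d × p n S ≡ U)) ×
  (∃[ S ] (Admissible {n} S × ∣ S ∣ ≡ d × p n S ≡ L))

-- With n = 1 + 2d + k, the exponents n-d-1 and n-2d-1 are `d + k` and `k`, and the Stirling
-- argument n-d is `suc (d + k)`.
bounds : ∀ d k → Bounds d (suc (2 * d + k)) (2 ^ (d + k)) (d ! * suc d ! * 2 ^ k * stirling₂ (suc (d + k)) (suc d))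
bounds d k = (λ S adm ∣S∣≡d → lower S adm ∣S∣≡d , upper S ∣S∣≡d) , upper-tight , lower-tight
  where
  n = 2 * d + k
  U = d ! * suc d ! * 2 ^ k * stirling₂ (suc (d + k)) (suc d)

  d+d+k : ∀ d k → d + suc (d + k) ≡ suc (2 * d + k)
  d+d+k = solve-∀

  trues≡ : ∀ (S : Subset (suc n)) → ∣ S ∣ ≡ d → trues (bits S) ≡ d
  trues≡ S ∣S∣≡d = ≡-trans (trues-bits S) ∣S∣≡d

  falses≡ : ∀ (S : Subset (suc n)) → ∣ S ∣ ≡ d → falses (bits S) ≡ suc (d + k)
  falses≡ S ∣S∣≡d = +-cancelˡ-≡ d _ _ (begin
    d + falses (bits S)                   ≡⟨ cong (_+ falses (bits S)) (trues≡ S ∣S∣≡d) ⟨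
    trues (bits S) + falses (bits S)      ≡⟨ trues+falses (bits S) ⟩
    length (bits S)                       ≡⟨ length-applyDownFrom (member S) (suc n) ⟩
    suc n                                 ≡⟨ d+d+k d k ⟨
    d + suc (d + k) ∎)
    where open ≡-Reasoning

  lower : ∀ S → Admissible S → ∣ S ∣ ≡ d → 2 ^ (d + k) ≤ p (suc n) S
  lower S adm ∣S∣≡d = *-cancelˡ-≤ 2 (begin
    2 * 2 ^ (d + k)                ≡⟨ cong (2 ^_) (falses≡ S ∣S∣≡d) ⟨
    2 ^ falses (bits S)            ≤⟨ H-lower (bits S) 0 (admissible⇒H₁>0 S adm) ⟩
    2 * (H 1 (bits S) * 1)         ≡⟨ cong (2 *_) (*-identityʳ (H 1 (bits S))) ⟩
    2 * H 1 (bits S)               ≡⟨ cong (2 *_) (p≡H n S) ⟨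
    2 * p (suc n) S ∎)
    where open ≤-Reasoning

  upper : ∀ S → ∣ S ∣ ≡ d → p (suc n) S ≤ U
  upper S ∣S∣≡d = begin
    p (suc n) S                                            ≡⟨ p≡H n S ⟩
    H 1 (bits S)                                           ≤⟨ H≤H-sorted (bits S) 1 ⟩
    H 1 (sorted (trues (bits S)) (falses (bits S)))        ≡⟨ cong₂ (λ q m → H 1 (sorted q m)) (trues≡ S ∣S∣≡d) (falses≡ S ∣S∣≡d) ⟩
    H 1 (sorted d (suc (d + k)))                           ≡⟨ H-sorted d k ⟩
    U ∎
    where open ≤-Reasoning

  realize : ∀ r → length r ≡ suc n → trues r ≡ d → ∃[ S ] (∣ S ∣ ≡ d × p (suc n) S ≡ H 1 r)
  realize r ∣r∣ tr =
    let (S , eq) = bits-surjective r ∣r∣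
    in S , ≡-trans (sym (trues-bits S)) (≡-trans (cong trues eq) tr) , ≡-trans (p≡H n S) (cong (H 1) eq)

  lower-tight : ∃[ S ] (Admissible S × ∣ S ∣ ≡ d × p (suc n) S ≡ 2 ^ (d + k))
  lower-tight =
    let (S , ∣S∣≡d , eq) = realize (sparse d k)
          (≡-trans (sym (trues+falses (sparse d k)))
            (≡-trans (cong₂ _+_ (trues-sparse d k) (falses-sparse d k)) (d+d+k d k)))
          (trues-sparse d k)
        p≡ = ≡-trans eq (H-sparse d k)
    in S , p>0⇒admissible S (subst (_> 0) (sym p≡) (m^n>0 2 (d + k))) , ∣S∣≡d , p≡

  upper-tight : ∃[ S ] (Admissible S × ∣ S ∣ ≡ d × p (suc n) S ≡ U)
  upper-tight =
    let (S , ∣S∣≡d , eq) = realize (sorted d (suc (d + k)))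
          (≡-trans (length-++ (replicate d true))
            (≡-trans (cong₂ _+_ (length-replicate d) (length-replicate (suc (d + k)))) (d+d+k d k)))
          (trues-sorted d (suc (d + k)))
        -- Admissibility of the extremal set requires `U > 0`. The set `T` attaining the lower bound
        -- has count `2 ^ (d + k)`, and this is at most `U`.
        (T , _ , ∣T∣≡d , eqT) = lower-tight
        p≡ = ≡-trans eq (H-sorted d k)
        p>0 = ≤-trans (m^n>0 2 (d + k)) (≤-trans (≤-reflexive (sym eqT))
                (≤-trans (upper T ∣T∣≡d) (≤-reflexive (sym p≡))))
    in S , p>0⇒admissible S p>0 , ∣S∣≡d , p≡

theorem1p9 : (d n : ℕ) → 1 ≤ d → 1 ≤ n → 2 * d < n →
    ((S : Subset n) → Admissible S → ∣ S ∣ ≡ d →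
    2 ^ (n ∸ d ∸ 1) ≤ p n S ×
    p n S ≤ d ! * (d + 1) ! * 2 ^ (n ∸ 2 * d ∸ 1) * stirling₂ (n ∸ d) (d + 1)) ×
    (∃[ S ] (Admissible {n} S × ∣ S ∣ ≡ d ×
    p n S ≡ d ! * (d + 1) ! * 2 ^ (n ∸ 2 * d ∸ 1) * stirling₂ (n ∸ d) (d + 1))) ×
    (∃[ S ] (Admissible {n} S × ∣ S ∣ ≡ d ×
    p n S ≡ 2 ^ (n ∸ d ∸ 1)))
theorem1p9 d n _ _ 2d<n = go (m≤n⇒∃[o]m+o≡n 2d<n)
  where
  go : ∃[ k ] suc (2 * d) + k ≡ n →
    Bounds d n (2 ^ (n ∸ d ∸ 1)) (d ! * (d + 1) ! * 2 ^ (n ∸ 2 * d ∸ 1) * stirling₂ (n ∸ d) (d + 1))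
  go (k , n≡) = subst₂ (Bounds d n)
    (cong (λ m → 2 ^ (m ∸ 1)) (sym n∸d))
    (cong₂ _*_
      (cong₂ (λ e l → d ! * e ! * 2 ^ (l ∸ 1)) (+-comm 1 d) (sym n∸2d))
      (cong₂ stirling₂ (sym n∸d) (+-comm 1 d)))
    (subst (λ m → Bounds d m (2 ^ (d + k)) (d ! * suc d ! * 2 ^ k * stirling₂ (suc (d + k)) (suc d))) n≡
      (bounds d k))
    where
    regroup : ∀ d k → suc (2 * d) + k ≡ d + suc (d + k)
    regroup = solve-∀
    n∸d : n ∸ d ≡ suc (d + k)
    n∸d = ≡-trans (cong (_∸ d) (≡-trans (sym n≡) (regroup d k))) (m+n∸m≡n d (suc (d + k)))
    n∸2d : n ∸ 2 * d ≡ suc k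
    n∸2d = ≡-trans (cong (_∸ 2 * d) (≡-trans (sym n≡) (sym (+-suc (2 * d) k)))) (m+n∸m≡n (2 * d) (suc k))
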